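{- For every $\varepsilon>0$ there exists $C\in\mathbb{R}$ such that, with high probability (i.e. with probability tending to $1$ as $n\to\infty$), the random graph $G\sim G(n,C/n)$ has the following property: there exists a subset $V'\subseteq[n]$ of size $|V'|\ge(1-\varepsilon)n$ for which the induced subgraph $G[V']$ is globally rigid in $\mathbb{R}$.
   Context: $G(n,p)$ is the Erdős–Rényi random graph on the vertex set $[n]=\{1,\dots,n\}$, in which each pair of vertices is an edge independently with probability $p$. Global rigidity in $\mathbb{R}$ (injective version): a simple graph $H=(V,E)$ is globally rigid in $\mathbb{R}$ if for every two injective functions $f,g:V\to\mathbb{R}$ satisfying $|f(x)-f(y)|=|g(x)-g(y)|$ for every edge $xy\in E$, we also have $|f(x)-f(y)|=|g(x)-g(y)|$ for every pair $x,y\in V$. -}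

module Defs where

open import Data.Bool using (Bool; true; false; T; if_then_else_)
open import Data.Empty using (⊥)
open import Data.Fin using (Fin; zero; suc)
open import Data.Fin.Subset using (Subset; _∈_)
import Data.Integer as ℤ
open import Data.List using (List; []; _∷_; _++_; map; foldr; filterᵇ; cartesianProduct)
open import Data.Nat as ℕ using (ℕ; zero; suc; NonZero; _⊔_)
import Data.Nat.Properties as ℕₚ
open import Data.Product using (Σ; ∃-syntax; _×_; _,_; proj₁)
open import Data.Rational as ℚ using (ℚ; 0ℚ; 1ℚ; ½)
import Data.Rational.Properties as ℚₚ
open import Data.Rational.Solver using (module +-*-Solver)
open import Data.Sum using (inj₁; inj₂)
open import Data.Unit using (⊤; tt)
open import Data.Vec using (Vec; []; _∷_; lookup)
open import Function.Definitions using (Injective)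
open import Relation.Nullary using (¬_)
open import Relation.Binary.PropositionalEquality using (_≡_; refl; sym; trans; cong; cong₂; subst)

------------------------------------------------------------------------
-- Real numbers, as Cauchy sequences of rationals

IsCauchy : (ℕ → ℚ) → Set
IsCauchy x = ∀ ε → 0ℚ ℚ.< ε →
  ∃[ N ] (∀ m n → N ℕ.≤ m → N ℕ.≤ n → ℚ.∣ x m ℚ.- x n ∣ ℚ.≤ ε)

record ℝ : Set where
  constructor mkℝ
  field
    seq    : ℕ → ℚ
    cauchy : IsCauchy seq

open ℝ public

infix 4 _≈_ _≤_ _<_

-- Equality of reals: `ℝ` is used as a setoid, never through `_≡_`.
_≈_ : ℝ → ℝ → Set
x ≈ y = ∀ ε → 0ℚ ℚ.< ε →
  ∃[ N ] (∀ n → N ℕ.≤ n → ℚ.∣ seq x n ℚ.- seq y n ∣ ℚ.≤ ε)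

_≤_ : ℝ → ℝ → Set
x ≤ y = ∀ ε → 0ℚ ℚ.< ε →
  ∃[ N ] (∀ n → N ℕ.≤ n → seq x n ℚ.≤ seq y n ℚ.+ ε)

_<_ : ℝ → ℝ → Set
x < y = ∃[ ε ] (0ℚ ℚ.< ε ×
  ∃[ N ] (∀ n → N ℕ.≤ n → seq x n ℚ.+ ε ℚ.≤ seq y n))

private
  open +-*-Solver

  0<½* : ∀ {ε} → 0ℚ ℚ.< ε → 0ℚ ℚ.< ½ ℚ.* ε
  0<½* {ε} 0<ε = subst (ℚ._< ½ ℚ.* ε) (ℚₚ.*-zeroʳ ½) (ℚₚ.*-monoʳ-<-pos ½ 0<ε)

  halves : ∀ ε → ½ ℚ.* ε ℚ.+ ½ ℚ.* ε ≡ ε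
  halves = solve 1 (λ e → con ½ :* e :+ con ½ :* e := e) refl

  ∣-∣-sym : ∀ a b → ℚ.∣ a ℚ.- b ∣ ≡ ℚ.∣ b ℚ.- a ∣
  ∣-∣-sym a b = trans (sym (ℚₚ.∣-p∣≡∣p∣ (a ℚ.- b)))
    (cong ℚ.∣_∣ (solve 2 (λ a b → :- (a :- b) := b :- a) refl a b))

  ∣a∣≤∣b∣+∣a-b∣ : ∀ a b → ℚ.∣ a ∣ ℚ.≤ ℚ.∣ b ∣ ℚ.+ ℚ.∣ a ℚ.- b ∣
  ∣a∣≤∣b∣+∣a-b∣ a b =
    subst (λ t → ℚ.∣ t ∣ ℚ.≤ ℚ.∣ b ∣ ℚ.+ ℚ.∣ a ℚ.- b ∣)
      (solve 2 (λ a b → b :+ (a :- b) := a) refl a b)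
      (ℚₚ.∣p+q∣≤∣p∣+∣q∣ b (a ℚ.- b))

  ∣a∣-∣b∣≤∣a-b∣ : ∀ a b → ℚ.∣ a ∣ ℚ.- ℚ.∣ b ∣ ℚ.≤ ℚ.∣ a ℚ.- b ∣
  ∣a∣-∣b∣≤∣a-b∣ a b =
    subst (ℚ.∣ a ∣ ℚ.- ℚ.∣ b ∣ ℚ.≤_)
      (solve 2 (λ b c → (b :+ c) :- b := c) refl ℚ.∣ b ∣ ℚ.∣ a ℚ.- b ∣)
      (ℚₚ.+-monoˡ-≤ (ℚ.- ℚ.∣ b ∣) (∣a∣≤∣b∣+∣a-b∣ a b))

  reverse-triangle : ∀ a b → ℚ.∣ ℚ.∣ a ∣ ℚ.- ℚ.∣ b ∣ ∣ ℚ.≤ ℚ.∣ a ℚ.- b ∣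
  reverse-triangle a b with ℚₚ.∣p∣≡p∨∣p∣≡-p (ℚ.∣ a ∣ ℚ.- ℚ.∣ b ∣)
  ... | inj₁ e = subst (ℚ._≤ ℚ.∣ a ℚ.- b ∣) (sym e) (∣a∣-∣b∣≤∣a-b∣ a b)
  ... | inj₂ e = subst (ℚ._≤ ℚ.∣ a ℚ.- b ∣)
    (sym (trans e (solve 2 (λ a b → :- (a :- b) := b :- a) refl ℚ.∣ a ∣ ℚ.∣ b ∣)))
    (subst (ℚ.∣ b ∣ ℚ.- ℚ.∣ a ∣ ℚ.≤_) (∣-∣-sym b a) (∣a∣-∣b∣≤∣a-b∣ b a))

  const-cauchy : ∀ q → IsCauchy (λ _ → q)
  const-cauchy q ε 0<ε = 0 , λ _ _ _ _ →
    subst (λ t → ℚ.∣ t ∣ ℚ.≤ ε) (sym (ℚₚ.+-inverseʳ q)) (ℚₚ.<⇒≤ 0<ε)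

  lipschitz-cauchy : ∀ (h : ℚ → ℚ) →
    (∀ a b → ℚ.∣ h a ℚ.- h b ∣ ℚ.≤ ℚ.∣ a ℚ.- b ∣) →
    ∀ {x} → IsCauchy x → IsCauchy (λ n → h (x n))
  lipschitz-cauchy h lip cx ε 0<ε with cx ε 0<ε
  ... | N , near = N , λ m n N≤m N≤n → ℚₚ.≤-trans (lip _ _) (near m n N≤m N≤n)

  +-cauchy : ∀ {x y} → IsCauchy x → IsCauchy y → IsCauchy (λ n → x n ℚ.+ y n)
  +-cauchy {x} {y} cx cy ε 0<ε with cx (½ ℚ.* ε) (0<½* 0<ε) | cy (½ ℚ.* ε) (0<½* 0<ε)
  ... | M , nearx | N , neary = M ⊔ N , λ m n le le′ → begin
    ℚ.∣ (x m ℚ.+ y m) ℚ.- (x n ℚ.+ y n) ∣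
      ≡⟨ cong ℚ.∣_∣ (solve 4 (λ a b c d → (a :+ b) :- (c :+ d) := (a :- c) :+ (b :- d))
           refl (x m) (y m) (x n) (y n)) ⟩
    ℚ.∣ (x m ℚ.- x n) ℚ.+ (y m ℚ.- y n) ∣
      ≤⟨ ℚₚ.∣p+q∣≤∣p∣+∣q∣ (x m ℚ.- x n) (y m ℚ.- y n) ⟩
    ℚ.∣ x m ℚ.- x n ∣ ℚ.+ ℚ.∣ y m ℚ.- y n ∣
      ≤⟨ ℚₚ.+-mono-≤
           (nearx m n (ℕₚ.m⊔n≤o⇒m≤o M N le) (ℕₚ.m⊔n≤o⇒m≤o M N le′))
           (neary m n (ℕₚ.m⊔n≤o⇒n≤o M N le) (ℕₚ.m⊔n≤o⇒n≤o M N le′)) ⟩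
    ½ ℚ.* ε ℚ.+ ½ ℚ.* ε
      ≡⟨ halves ε ⟩
    ε ∎
    where open ℚₚ.≤-Reasoning

  EventuallyBounded : (ℕ → ℚ) → Set
  EventuallyBounded x = Σ ℚ λ B → ℚ.Positive B × ∃[ N ] (∀ n → N ℕ.≤ n → ℚ.∣ x n ∣ ℚ.≤ B)

  eventually-bounded : ∀ {x} → IsCauchy x → EventuallyBounded x
  eventually-bounded {x} cx with cx 1ℚ (ℚₚ.positive⁻¹ 1ℚ)
  ... | N , near = ℚ.∣ x N ∣ ℚ.+ 1ℚ
    , ℚₚ.nonNeg+pos⇒pos ℚ.∣ x N ∣ {{ℚₚ.∣-∣-nonNeg (x N)}} 1ℚ
    , N , λ n N≤n → ℚₚ.≤-trans (∣a∣≤∣b∣+∣a-b∣ (x n) (x N))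
        (ℚₚ.+-monoʳ-≤ ℚ.∣ x N ∣ (near n N N≤n ℕₚ.≤-refl))

  scale : ∀ B → ℚ.Positive B → ∀ ε → 0ℚ ℚ.< ε → ∃[ δ ] (0ℚ ℚ.< δ × B ℚ.* δ ≡ ε)
  scale B B>0 ε 0<ε = B⁻¹ ℚ.* ε
    , subst (ℚ._< B⁻¹ ℚ.* ε) (ℚₚ.*-zeroʳ B⁻¹) (ℚₚ.*-monoʳ-<-pos B⁻¹ 0<ε)
    , trans (sym (ℚₚ.*-assoc B B⁻¹ ε))
        (trans (cong (ℚ._* ε) (ℚₚ.*-inverseʳ B)) (ℚₚ.*-identityˡ ε))
    where
    instance
      B-pos : ℚ.Positive B
      B-pos = B>0
      B-nonZero : ℚ.NonZero B
      B-nonZero = ℚₚ.pos⇒nonZero B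
    B⁻¹ : ℚ
    B⁻¹ = ℚ.1/ B
    instance
      B⁻¹-pos : ℚ.Positive B⁻¹
      B⁻¹-pos = ℚₚ.1/pos⇒pos B

  *-bound : ∀ {B δ} → ℚ.Positive B → ∀ a b → ℚ.∣ a ∣ ℚ.≤ B → ℚ.∣ b ∣ ℚ.≤ δ →
    ℚ.∣ a ℚ.* b ∣ ℚ.≤ B ℚ.* δ
  *-bound {B} {δ} B>0 a b a≤ b≤ = begin
    ℚ.∣ a ℚ.* b ∣         ≡⟨ ℚₚ.∣p*q∣≡∣p∣*∣q∣ a b ⟩
    ℚ.∣ a ∣ ℚ.* ℚ.∣ b ∣   ≤⟨ ℚₚ.*-monoʳ-≤-nonNeg ℚ.∣ b ∣ {{ℚₚ.∣-∣-nonNeg b}} a≤ ⟩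
    B ℚ.* ℚ.∣ b ∣         ≤⟨ ℚₚ.*-monoˡ-≤-nonNeg B {{ℚₚ.pos⇒nonNeg B {{B>0}}}} b≤ ⟩
    B ℚ.* δ ∎
    where open ℚₚ.≤-Reasoning

  *-difference : ∀ a b c d → a ℚ.* b ℚ.- c ℚ.* d ≡ a ℚ.* (b ℚ.- d) ℚ.+ d ℚ.* (a ℚ.- c)
  *-difference = solve 4 (λ a b c d → a :* b :- c :* d := a :* (b :- d) :+ d :* (a :- c)) refl

  *-near : ∀ {B D β δ η} → ℚ.Positive B → ℚ.Positive D → B ℚ.* β ≡ η → D ℚ.* δ ≡ η →
    ∀ a b c d → ℚ.∣ a ∣ ℚ.≤ B → ℚ.∣ b ℚ.- d ∣ ℚ.≤ β → ℚ.∣ d ∣ ℚ.≤ D → ℚ.∣ a ℚ.- c ∣ ℚ.≤ δ →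
    ℚ.∣ a ℚ.* b ℚ.- c ℚ.* d ∣ ℚ.≤ η ℚ.+ η
  *-near {B} {D} {β} {δ} {η} B>0 D>0 Bβ Dδ a b c d a≤ b-d≤ d≤ a-c≤ = begin
    ℚ.∣ a ℚ.* b ℚ.- c ℚ.* d ∣
      ≡⟨ cong ℚ.∣_∣ (*-difference a b c d) ⟩
    ℚ.∣ a ℚ.* (b ℚ.- d) ℚ.+ d ℚ.* (a ℚ.- c) ∣
      ≤⟨ ℚₚ.∣p+q∣≤∣p∣+∣q∣ (a ℚ.* (b ℚ.- d)) (d ℚ.* (a ℚ.- c)) ⟩
    ℚ.∣ a ℚ.* (b ℚ.- d) ∣ ℚ.+ ℚ.∣ d ℚ.* (a ℚ.- c) ∣
      ≤⟨ ℚₚ.+-mono-≤ (*-bound B>0 a (b ℚ.- d) a≤ b-d≤) (*-bound D>0 d (a ℚ.- c) d≤ a-c≤) ⟩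
    B ℚ.* β ℚ.+ D ℚ.* δ
      ≡⟨ cong₂ ℚ._+_ Bβ Dδ ⟩
    η ℚ.+ η ∎
    where open ℚₚ.≤-Reasoning

  *-cauchy : ∀ {x y} → IsCauchy x → IsCauchy y → IsCauchy (λ n → x n ℚ.* y n)
  *-cauchy {x} {y} cx cy ε 0<ε = go (eventually-bounded cx) (eventually-bounded cy)
    where
    η : ℚ
    η = ½ ℚ.* ε

    Near : (ℕ → ℚ) → ℚ → Set
    Near x ε = ∃[ N ] (∀ m n → N ℕ.≤ m → N ℕ.≤ n → ℚ.∣ x m ℚ.- x n ∣ ℚ.≤ ε)

    go : EventuallyBounded x → EventuallyBounded y → Near (λ n → x n ℚ.* y n) ε
    go (B , B>0 , K , bx) (D , D>0 , L , by) =
      go′ (scale B B>0 η (0<½* 0<ε)) (scale D D>0 η (0<½* 0<ε))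
      where
      go′ : ∃[ β ] (0ℚ ℚ.< β × B ℚ.* β ≡ η) → ∃[ δ ] (0ℚ ℚ.< δ × D ℚ.* δ ≡ η) →
        Near (λ n → x n ℚ.* y n) ε
      go′ (β , 0<β , Bβ) (δ , 0<δ , Dδ) = go″ (cx δ 0<δ) (cy β 0<β)
        where
        go″ : Near x δ → Near y β → Near (λ n → x n ℚ.* y n) ε
        go″ (M , nearx) (N , neary) = (K ⊔ L) ⊔ (M ⊔ N) , λ m n le le′ →
          subst (ℚ.∣ x m ℚ.* y m ℚ.- x n ℚ.* y n ∣ ℚ.≤_) (halves ε)
            (*-near B>0 D>0 Bβ Dδ (x m) (y m) (x n) (y n)
              (bx m (≤K le)) (neary m n (≤N le) (≤N le′))
              (by n (≤L le′)) (nearx m n (≤M le) (≤M le′)))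
          where
          ≤K : ∀ {n} → (K ⊔ L) ⊔ (M ⊔ N) ℕ.≤ n → K ℕ.≤ n
          ≤K le = ℕₚ.m⊔n≤o⇒m≤o K L (ℕₚ.m⊔n≤o⇒m≤o (K ⊔ L) (M ⊔ N) le)
          ≤L : ∀ {n} → (K ⊔ L) ⊔ (M ⊔ N) ℕ.≤ n → L ℕ.≤ n
          ≤L le = ℕₚ.m⊔n≤o⇒n≤o K L (ℕₚ.m⊔n≤o⇒m≤o (K ⊔ L) (M ⊔ N) le)
          ≤M : ∀ {n} → (K ⊔ L) ⊔ (M ⊔ N) ℕ.≤ n → M ℕ.≤ n
          ≤M le = ℕₚ.m⊔n≤o⇒m≤o M N (ℕₚ.m⊔n≤o⇒n≤o (K ⊔ L) (M ⊔ N) le)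
          ≤N : ∀ {n} → (K ⊔ L) ⊔ (M ⊔ N) ℕ.≤ n → N ℕ.≤ n
          ≤N le = ℕₚ.m⊔n≤o⇒n≤o M N (ℕₚ.m⊔n≤o⇒n≤o (K ⊔ L) (M ⊔ N) le)

infixl 6 _+_ _-_
infixl 7 _*_ _/ℕ_
infix  8 -_

fromℚ : ℚ → ℝ
fromℚ q = mkℝ (λ _ → q) (const-cauchy q)

fromℕ : ℕ → ℝ
fromℕ n = fromℚ (ℤ.+ n ℚ./ 1)

0ℝ 1ℝ : ℝ
0ℝ = fromℚ 0ℚ
1ℝ = fromℚ 1ℚ

_+_ : ℝ → ℝ → ℝ
x + y = mkℝ (λ n → seq x n ℚ.+ seq y n) (+-cauchy {seq x} {seq y} (cauchy x) (cauchy y))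

_*_ : ℝ → ℝ → ℝ
x * y = mkℝ (λ n → seq x n ℚ.* seq y n) (*-cauchy {seq x} {seq y} (cauchy x) (cauchy y))

-_ : ℝ → ℝ
- x = mkℝ (λ n → ℚ.- seq x n) (lipschitz-cauchy ℚ.-_ neg-lip {seq x} (cauchy x))
  where
  neg-lip : ∀ a b → ℚ.∣ ℚ.- a ℚ.- ℚ.- b ∣ ℚ.≤ ℚ.∣ a ℚ.- b ∣
  neg-lip a b = ℚₚ.≤-reflexive (trans
    (cong ℚ.∣_∣ (solve 2 (λ a b → :- a :- :- b := b :- a) refl a b)) (∣-∣-sym b a))

_-_ : ℝ → ℝ → ℝ
x - y = x + (- y)

∣_∣ : ℝ → ℝ
∣ x ∣ = mkℝ (λ n → ℚ.∣ seq x n ∣) (lipschitz-cauchy ℚ.∣_∣ reverse-triangle {seq x} (cauchy x))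

_/ℕ_ : ℝ → (n : ℕ) → .{{_ : NonZero n}} → ℝ
x /ℕ n = x * fromℚ (ℤ.+ 1 ℚ./ n)

------------------------------------------------------------------------
-- Simple graphs and global rigidity

record SimpleGraph (V : Set) : Set₁ where
  field
    Adj     : V → V → Set
    Adj-sym : ∀ {x y} → Adj x y → Adj y x
    irrefl  : ∀ {x} → ¬ Adj x x

open SimpleGraph public

induced : ∀ {n} → SimpleGraph (Fin n) → (S : Subset n) → SimpleGraph (∃[ i ] i ∈ S)
induced G S = record
  { Adj     = λ x y → Adj G (proj₁ x) (proj₁ y)
  ; Adj-sym = Adj-sym G
  ; irrefl  = irrefl G
  }

GloballyRigid : {V : Set} → SimpleGraph V → Set
GloballyRigid {V} H = ∀ (f g : V → ℝ) →
  Injective _≡_ _≈_ f → Injective _≡_ _≈_ g →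
  (∀ {x y} → Adj H x y → ∣ f x - f y ∣ ≈ ∣ g x - g y ∣) →
  ∀ x y → ∣ f x - f y ∣ ≈ ∣ g x - g y ∣

------------------------------------------------------------------------
-- The random graph G(n,p)

-- The sample space, with one Boolean for each pair of vertices: the first
-- component lists which of the pairs {0,1}, …, {0,n} are edges, the second
-- does the same for the pairs among the vertices 1, …, n.
Outcome : ℕ → Set
Outcome zero    = ⊤
Outcome (suc n) = Vec Bool n × Outcome n

edge : ∀ {n} → Outcome n → Fin n → Fin n → Bool
edge (b , ω) zero    zero    = false
edge (b , ω) zero    (suc j) = lookup b j
edge (b , ω) (suc i) zero    = lookup b i
edge (b , ω) (suc i) (suc j) = edge ω i j

graph : ∀ {n} → Outcome n → SimpleGraph (Fin n)
graph ω = record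
  { Adj     = λ i j → T (edge ω i j)
  ; Adj-sym = λ {i} {j} → edge-sym ω i j
  ; irrefl  = λ {i} → edge-irrefl ω i
  }
  where
  edge-sym : ∀ {n} (ω : Outcome n) i j → T (edge ω i j) → T (edge ω j i)
  edge-sym (b , ω) zero    (suc j) e = e
  edge-sym (b , ω) (suc i) zero    e = e
  edge-sym (b , ω) (suc i) (suc j) e = edge-sym ω i j e

  edge-irrefl : ∀ {n} (ω : Outcome n) i → T (edge ω i i) → ⊥
  edge-irrefl (b , ω) (suc i) e = edge-irrefl ω i e

allBits : ∀ m → List (Vec Bool m)
allBits zero    = [] ∷ []
allBits (suc m) = map (true ∷_) (allBits m) ++ map (false ∷_) (allBits m)

allOutcomes : ∀ n → List (Outcome n)
allOutcomes zero    = tt ∷ []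
allOutcomes (suc n) = cartesianProduct (allBits n) (allOutcomes n)

-- By independence, the mass of an outcome is the product over all pairs of
-- p (edge) or 1 - p (non-edge).
bitsMass : ∀ {m} → ℝ → Vec Bool m → ℝ
bitsMass p []      = 1ℝ
bitsMass p (b ∷ v) = (if b then p else (1ℝ - p)) * bitsMass p v

mass : ∀ {n} → ℝ → Outcome n → ℝ
mass {zero}  p _       = 1ℝ
mass {suc n} p (b , ω) = bitsMass p b * mass p ω

Event : ℕ → Set
Event n = Outcome n → Bool

ℙ : ∀ {n} → ℝ → Event n → ℝ
ℙ {n} p E = foldr _+_ 0ℝ (map (mass p) (filterᵇ E (allOutcomes n)))

-- A graph property need not come with a decision procedure, so a lower bound
-- on its probability is witnessed by a Boolean event contained in it.  As the
-- sample space is finite, this is classically the same as bounding the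
-- probability of the property itself.
ProbabilityAtLeast : ∀ {n} → ℝ → (SimpleGraph (Fin n) → Set) → ℝ → Set
ProbabilityAtLeast {n} p A r =
  Σ (Event n) λ E → (∀ ω → T (E ω) → A (graph ω)) × (r ≤ ℙ p E)

-- Under G(n, p n), the probability of A n tends to 1.  Only large n matter,
-- and for these p n is required to be a probability, since otherwise `mass`
-- could take negative values.
WithHighProbability : ((n : ℕ) → .{{_ : NonZero n}} → ℝ) →
                      (∀ n → SimpleGraph (Fin n) → Set) → Set
WithHighProbability p A = ∀ δ → 0ℝ < δ →
  ∃[ N ] (∀ n → .{{_ : NonZero n}} → N ℕ.≤ n →
    (0ℝ ≤ p n) × (p n ≤ 1ℝ) × ProbabilityAtLeast (p n) (A n) (1ℝ - δ))

{-# OPTIONS --safe #-}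

-- Write a = f − g and b = f + g on the vertices. An edge of an instance of the rigidity problem
-- joins two vertices with the same a (the same row) or the same b (the same column), and a row
-- and a column share at most one vertex. Suppose that any two disjoint sets of at least s vertices
-- are joined by an edge. Then the rows and the columns cannot both be grouped into balanced halves,
-- since opposite quadrants have no edge between them; so some row (or column) ρ misses at most
-- 4s vertices. Call a set W loose if each of its vertices has at most one neighbour outside W.
-- A loose set with at most 5s vertices has fewer than s, because its outer neighbourhood is no
-- larger than the set itself. Let V′ be the complement of a largest loose set W with fewer than s
-- vertices. A vertex of V′ outside ρ has at most one neighbour in ρ, the one in its own column,
-- so the complement of ρ is loose too; maximality gives V′ = ρ. Finally, if p = C/n then the
-- expected number of pairs of disjoint s-sets with no edge between them is at most
-- 4ⁿ (1 − p)^(s²), which tends to 0 when s = n/d and C is a large multiple of d².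
module Submission where

open import Defs
open import Data.Fin.Subset using (Subset) renaming (∣_∣ to card)
open import Data.Product using (Σ; _×_)

open import Algebra.Bundles using (CommutativeRing)
open import Data.Bool using (Bool; true; false; T; if_then_else_)
open import Data.Empty using (⊥; ⊥-elim)
open import Data.Fin using (Fin; zero; suc)
import Data.Fin.Properties as Finₚ
open import Data.Fin.Subset using (inside; outside; _∈_; _∉_; _⊆_; ∁; _─_; _∩_; ⁅_⁆)
  renaming (_-_ to _-ₛ_; ⊥ to ∅; ⊤ to full)
open import Data.Fin.Subset.Properties
import Data.Integer as ℤ
import Data.Integer.Properties as ℤₚ
open import Data.List using (List; []; _∷_; _++_; map; foldr; filterᵇ; cartesianProduct; allFin)
open import Data.List.Membership.Propositional.Properties using (∈-allFin)
open import Data.List.Relation.Unary.Any as Any using (Any; here; there)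
open import Data.Nat as ℕ using (ℕ; zero; suc; NonZero; _⊔_; z≤n; s≤s)
open import Data.Nat.DivMod using (m/n*n≤m; m≥n⇒m/n>0; m≡m%n+[m/n]*n; m%n<n)
import Data.Nat.Properties as ℕₚ
open import Data.Nat.Tactic.RingSolver using (solve-∀)
open import Data.Product using (∃-syntax; _,_; proj₁; proj₂)
open import Data.Rational as ℚ using (ℚ; 0ℚ; 1ℚ; ½)
import Data.Rational.Properties as ℚₚ
open import Data.Rational.Solver using (module +-*-Solver)
open import Data.Rational.Unnormalised as ℚᵘ using (mkℚᵘ; *≡*)
import Data.Rational.Unnormalised.Properties as ℚᵘₚ
open import Data.Sum as Sum using (_⊎_; inj₁; inj₂; [_,_]′)
open import Data.Unit using (tt)
open import Data.Vec using (Vec; []; _∷_; lookup; tabulate)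
open import Data.Vec.Base using (here; there)
open import Data.Vec.Properties using (lookup⇒[]=; []=⇒lookup; lookup∘tabulate)
open import Data.Vec.Properties.WithK using ([]=-irrelevant)
open import Function using (_∘_; const)
open import Relation.Binary using (Reflexive; Symmetric; Transitive)
  renaming (Decidable to Decidable₂)
open import Relation.Binary.PropositionalEquality
  using (_≡_; refl; sym; trans; cong; cong₂; subst; subst₂; module ≡-Reasoning)
open import Relation.Nullary using (¬_; Dec; yes; no; does; contradiction)
open import Relation.Nullary.Decidable
  using (_×-dec_; _→-dec_; ¬?; T?; dec-true; ¬¬-excluded-middle)
open import Relation.Unary using (Decidable)

open import Algebra.Properties.CommutativeSemiring.Exp
  (CommutativeRing.commutativeSemiring ℚₚ.+-*-commutativeRing)
  using (_^_; ^-homo-*; ^-assocʳ; ^-distrib-*)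
open +-*-Solver using (solve; con; _:+_; _:*_; _:-_; :-_; _:=_)

private variable n : ℕ

-- Finite sets

subsetOf : {P : Fin n → Set} → Decidable P → Subset n
subsetOf P? = tabulate (does ∘ P?)

∈-subsetOf⁺ : ∀ {P : Fin n → Set} (P? : Decidable P) {x} → P x → x ∈ subsetOf P?
∈-subsetOf⁺ P? {x} px =
  lookup⇒[]= x _ (trans (lookup∘tabulate (does ∘ P?) x) (dec-true (P? x) px))

∈-subsetOf⁻ : ∀ {P : Fin n → Set} (P? : Decidable P) {x} → x ∈ subsetOf P? → P x
∈-subsetOf⁻ P? {x} x∈
  with P? x | trans (sym (lookup∘tabulate (does ∘ P?) x)) ([]=⇒lookup x∈)
... | yes px | _ = px
... | no  _  | ()

∈─⇒∉ : (p q : Subset n) → ∀ {x} → x ∈ p ─ q → x ∉ q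
∈─⇒∉ (_ ∷ p) (outside ∷ q) (there x∈) (there x∈q) = ∈─⇒∉ p q x∈ x∈q
∈─⇒∉ (_ ∷ p) (inside ∷ q) (there x∈) (there x∈q) = ∈─⇒∉ p q x∈ x∈q

card-cover : (p q r : Subset n) → (∀ {x} → x ∈ p → x ∈ q ⊎ x ∈ r) →
  card p ℕ.≤ card q ℕ.+ card r
card-cover [] [] [] c = z≤n
card-cover (a ∷ p) (b ∷ q) (c ∷ r) cov = go a b c cov
  where
  rec : card p ℕ.≤ card q ℕ.+ card r
  rec = card-cover p q r λ x∈p → Sum.map drop-there drop-there (cov (there x∈p))
  go : ∀ a b c → (∀ {x} → x ∈ a ∷ p → x ∈ b ∷ q ⊎ x ∈ c ∷ r) →
    card (a ∷ p) ℕ.≤ card (b ∷ q) ℕ.+ card (c ∷ r)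
  go false b c cov = ℕₚ.≤-trans rec (ℕₚ.+-mono-≤ (∣p∣≤∣x∷p∣ b q) (∣p∣≤∣x∷p∣ c r))
  go true true c cov = s≤s (ℕₚ.≤-trans rec (ℕₚ.+-monoʳ-≤ (card q) (∣p∣≤∣x∷p∣ c r)))
  go true false true cov =
    ℕₚ.≤-trans (s≤s rec) (ℕₚ.≤-reflexive (sym (ℕₚ.+-suc (card q) (card r))))
  go true false false cov with cov here
  ... | inj₁ ()
  ... | inj₂ ()

-- Induction on `W`: its first element is related to at most one element `x₀` of `X`, and once `x₀`
-- is removed the rest of `W` still hits everything left in `X`.
card-image : ∀ {m} (W : Subset m) (X : Subset n) {r : Fin m → Fin n → Set} → Decidable₂ r →
  (∀ {x} → x ∈ X → ∃[ w ] w ∈ W × r w x) →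
  (∀ {w x y} → w ∈ W → x ∈ X → y ∈ X → r w x → r w y → x ≡ y) →
  card X ℕ.≤ card W
card-image {n} [] X r? hit _ =
  ℕₚ.≤-trans (p⊆q⇒∣p∣≤∣q∣ {q = ∅} (λ x∈ → no-witness (hit x∈))) (ℕₚ.≤-reflexive (∣⊥∣≡0 n))
  where
  no-witness : ∀ {B : Fin 0 → Set} {C : Set} → ∃[ w ] B w → C
  no-witness (() , _)
card-image (outside ∷ W) X r? hit one =
  card-image W X (r? ∘ suc) hit′ (one ∘ there)
  where
  hit′ : ∀ {x} → x ∈ X → ∃[ w ] w ∈ W × _
  hit′ x∈ with hit x∈
  ... | suc w , there w∈ , rwx = w , w∈ , rwx
card-image (inside ∷ W) X {r} r? hit one with Finₚ.any? (λ x → (x ∈? X) ×-dec r? zero x)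
... | no ¬x = ℕₚ.m≤n⇒m≤1+n (card-image W X (r? ∘ suc) hit′ (one ∘ there))
  where
  hit′ : ∀ {x} → x ∈ X → ∃[ w ] w ∈ W × r (suc w) x
  hit′ x∈ with hit x∈
  ... | zero  , _ , rx = contradiction (_ , x∈ , rx) ¬x
  ... | suc w , there w∈ , rwx = w , w∈ , rwx
... | yes (x₀ , x₀∈ , rx₀) = ℕₚ.≤-trans
  (card-cover X ⁅ x₀ ⁆ (X -ₛ x₀) split)
  (ℕₚ.+-mono-≤ (ℕₚ.≤-reflexive (∣⁅x⁆∣≡1 x₀))
    (card-image W (X -ₛ x₀) (r? ∘ suc) hit′
      (λ w∈ x∈ y∈ → one (there w∈) (p─q⊆p X _ x∈) (p─q⊆p X _ y∈))))
  where
  split : ∀ {x} → x ∈ X → x ∈ ⁅ x₀ ⁆ ⊎ x ∈ X -ₛ x₀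
  split {x} x∈ with x Finₚ.≟ x₀
  ... | yes refl = inj₁ (x∈⁅x⁆ x₀)
  ... | no x≢ = inj₂ (x∈p∧x≢y⇒x∈p-y x∈ x≢)
  hit′ : ∀ {x} → x ∈ X -ₛ x₀ → ∃[ w ] w ∈ W × r (suc w) x
  hit′ x∈ with hit (p─q⊆p X _ x∈)
  ... | suc w , there w∈ , rwx = w , w∈ , rwx
  ... | zero  , _ , rx with one here (p─q⊆p X _ x∈) x₀∈ rx rx₀
  ...   | refl = contradiction (x∈⁅x⁆ x₀) (∈─⇒∉ X ⁅ x₀ ⁆ x∈)

-- The current set is replaced by a larger one as long as possible. Since `card p + fuel` never
-- drops below `n`, the set is full once the fuel is used up.
maximum : {P : Subset n → Set} → Decidable P → ∀ {p} → P p →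
  ∃[ q ] P q × (∀ {r} → P r → card r ℕ.≤ card q)
maximum {n} {P} P? {p} Pp = climb n p Pp (ℕₚ.m≤n+m n (card p))
  where
  climb : ∀ fuel p → P p → n ℕ.≤ card p ℕ.+ fuel →
    ∃[ q ] P q × (∀ {r} → P r → card r ℕ.≤ card q)
  climb fuel p Pp bound with anySubset? (λ r → P? r ×-dec (card p ℕ.<? card r))
  ... | no none = p , Pp , λ {r} Pr → ℕₚ.≮⇒≥ λ p<r → none (r , Pr , p<r)
  climb zero p Pp bound | yes (r , Pr , p<r) =
    ⊥-elim (ℕₚ.<⇒≱ p<r (ℕₚ.≤-trans (∣p∣≤n r) (subst (n ℕ.≤_) (ℕₚ.+-identityʳ _) bound)))
  climb (suc fuel) p Pp bound | yes (r , Pr , p<r) = climb fuel r Pr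
    (ℕₚ.≤-trans bound (ℕₚ.≤-trans (ℕₚ.≤-reflexive (ℕₚ.+-suc _ fuel)) (ℕₚ.+-monoˡ-≤ fuel p<r)))

half : ∀ {s} (p q r : Subset n) → ¬ s ℕ.≤ card q → 2 ℕ.* s ℕ.≤ card p →
  (∀ {x} → x ∈ p → x ∈ q ⊎ x ∈ r) → s ℕ.≤ card r
half {s = s} p q r q<s 2s≤p cover = ℕₚ.+-cancelˡ-≤ s s (card r) (begin
  s ℕ.+ s            ≡⟨ cong (s ℕ.+_) (ℕₚ.+-identityʳ s) ⟨
  2 ℕ.* s            ≤⟨ 2s≤p ⟩
  card p             ≤⟨ card-cover p q r cover ⟩
  card q ℕ.+ card r  ≤⟨ ℕₚ.+-monoˡ-≤ (card r) (ℕₚ.<⇒≤ (ℕₚ.≰⇒> q<s)) ⟩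
  s ℕ.+ card r       ∎)
  where open ℕₚ.≤-Reasoning

-- Expansion

-- The part of `Separated` that does not mention the graph, split off so that the union bound can
-- run over the pairs that satisfy it.
LargePair : ℕ → Subset n → Subset n → Set
LargePair s A B = (∀ x → x ∈ A → x ∉ B) × s ℕ.≤ card A × s ℕ.≤ card B

largePair? : ∀ s → Decidable₂ (LargePair {n} s)
largePair? s A B = Finₚ.all? (λ x → (x ∈? A) →-dec ¬? (x ∈? B)) ×-dec
  (s ℕ.≤? card A) ×-dec (s ℕ.≤? card B)

module _ (Adj : Fin n → Fin n → Set) where

  Separated : ℕ → Subset n → Subset n → Set
  Separated s A B = LargePair s A B × (∀ a b → a ∈ A → b ∈ B → ¬ Adj a b)

  Joined : ℕ → Set
  Joined s = ∀ A B → ¬ Separated s A B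

  Loose : Subset n → Set
  Loose W = ∀ w x y → w ∈ W → x ∉ W → y ∉ W → Adj w x → Adj w y → x ≡ y

module _ {Adj : Fin n → Fin n → Set} (adj? : Decidable₂ Adj) where

  separated? : ∀ s → Decidable₂ (Separated Adj s)
  separated? s A B = largePair? s A B ×-dec
    Finₚ.all? (λ a → Finₚ.all? λ b → (a ∈? A) →-dec (b ∈? B) →-dec ¬? (adj? a b))

  joined⊎separated : ∀ s → Joined Adj s ⊎ (∃[ A ] ∃[ B ] Separated Adj s A B)
  joined⊎separated s with anySubset? (λ A → anySubset? (separated? s A))
  ... | yes sep = inj₂ sep
  ... | no none = inj₁ λ A B sep → none (A , B , sep)

  loose? : Decidable (Loose Adj)
  loose? W = Finₚ.all? λ w → Finₚ.all? λ x → Finₚ.all? λ y →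
    (w ∈? W) →-dec ¬? (x ∈? W) →-dec ¬? (y ∈? W) →-dec
    adj? w x →-dec adj? w y →-dec (x Finₚ.≟ y)

module Expansion {Adj : Fin n → Fin n → Set} (adj? : Decidable₂ Adj) (adj-sym : Symmetric Adj)
  (s : ℕ) (0<s : 0 ℕ.< s) (11s≤n : 11 ℕ.* s ℕ.≤ n) (joined : Joined Adj s) where

  -- Otherwise `W` and the set `Far` of vertices neither in `W` nor adjacent to it would be
  -- separated. By looseness the outer neighbourhood `N` is no larger than `W`, so `Far` keeps at
  -- least 11s - 5s - 5s vertices.
  loose⇒small : ∀ {W} → Loose Adj W → card W ℕ.≤ 5 ℕ.* s → card W ℕ.< s
  loose⇒small {W} loose W≤5s = ℕₚ.≰⇒> λ s≤W →
    joined W Far ((disjoint , s≤W , s≤Far) , far)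
    where
    touched? : Decidable (λ x → x ∉ W × ∃[ w ] w ∈ W × Adj w x)
    touched? x = ¬? (x ∈? W) ×-dec Finₚ.any? λ w → (w ∈? W) ×-dec adj? w x
    Far? : Decidable (λ x → x ∉ W × ¬ (∃[ w ] w ∈ W × Adj w x))
    Far? x = ¬? (x ∈? W) ×-dec ¬? (Finₚ.any? λ w → (w ∈? W) ×-dec adj? w x)
    N Far : Subset n
    N = subsetOf touched?
    Far = subsetOf Far?
    disjoint : ∀ x → x ∈ W → x ∉ Far
    disjoint x x∈W x∈Far = proj₁ (∈-subsetOf⁻ Far? x∈Far) x∈W
    far : ∀ a b → a ∈ W → b ∈ Far → ¬ Adj a b
    far a b a∈ b∈ ab = proj₂ (∈-subsetOf⁻ Far? b∈) (a , a∈ , ab)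
    N≤W : card N ℕ.≤ card W
    N≤W = card-image W N adj? (proj₂ ∘ ∈-subsetOf⁻ touched?)
      λ w∈ x∈ y∈ → loose _ _ _ w∈
        (proj₁ (∈-subsetOf⁻ touched? x∈)) (proj₁ (∈-subsetOf⁻ touched? y∈))
    cover₁ : ∀ {x} → x ∈ full → x ∈ W ⊎ x ∈ ∁ W
    cover₁ {x} _ with x ∈? W
    ... | yes x∈ = inj₁ x∈
    ... | no x∉ = inj₂ (x∉p⇒x∈∁p x∉)
    cover₂ : ∀ {x} → x ∈ ∁ W → x ∈ N ⊎ x ∈ Far
    cover₂ {x} x∈∁ with Finₚ.any? (λ w → (w ∈? W) ×-dec adj? w x)
    ... | yes t = inj₁ (∈-subsetOf⁺ touched? (x∈∁p⇒x∉p x∈∁ , t))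
    ... | no ¬t = inj₂ (∈-subsetOf⁺ Far? (x∈∁p⇒x∉p x∈∁ , ¬t))
    s≤Far : s ℕ.≤ card Far
    s≤Far = ℕₚ.+-cancelˡ-≤ (10 ℕ.* s) s (card Far) (begin
      10 ℕ.* s ℕ.+ s
        ≡⟨ ten s ⟩
      11 ℕ.* s
        ≤⟨ 11s≤n ⟩
      n
        ≡⟨ ∣⊤∣≡n n ⟨
      card (full {n})
        ≤⟨ card-cover full W (∁ W) cover₁ ⟩
      card W ℕ.+ card (∁ W)
        ≤⟨ ℕₚ.+-monoʳ-≤ (card W) (card-cover (∁ W) N Far cover₂) ⟩
      card W ℕ.+ (card N ℕ.+ card Far)
        ≤⟨ ℕₚ.+-mono-≤ W≤5s (ℕₚ.+-monoˡ-≤ (card Far) (ℕₚ.≤-trans N≤W W≤5s)) ⟩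
      5 ℕ.* s ℕ.+ (5 ℕ.* s ℕ.+ card Far)
        ≡⟨ five s (card Far) ⟩
      10 ℕ.* s ℕ.+ card Far ∎)
      where
      open ℕₚ.≤-Reasoning
      ten : ∀ s → 10 ℕ.* s ℕ.+ s ≡ 11 ℕ.* s
      ten = solve-∀
      five : ∀ s f → 5 ℕ.* s ℕ.+ (5 ℕ.* s ℕ.+ f) ≡ 10 ℕ.* s ℕ.+ f
      five = solve-∀

  -- The empty set starts the search: it is loose, and smaller than `s` because `s` is positive.
  core : ∃[ W ] (Loose Adj W × card W ℕ.< s) ×
    (∀ {X} → Loose Adj X × card X ℕ.< s → card X ℕ.≤ card W)
  core = maximum (λ W → loose? adj? W ×-dec (card W ℕ.<? s))
    {∅} ((λ w x y w∈ → ⊥-elim (∉⊥ w∈)) , subst (ℕ._< s) (sym (∣⊥∣≡0 n)) 0<s)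

  -- Partial equivalence relations and unions of their classes

  module Classes (V : Subset n) where

    -- An equivalence relation on `V`, encoded on all of `Fin n` and empty outside `V`, so that its
    -- classes are again subsets of `Fin n`.
    record PartialEquivalence : Set₁ where
      field
        _~_     : Fin n → Fin n → Set
        dec     : Decidable₂ _~_
        ~-sym   : Symmetric _~_
        ~-trans : Transitive _~_
        ~-refl  : ∀ {x} → x ∈ V → x ~ x
        ~-dom   : ∀ {x y} → x ~ y → x ∈ V

      class : Fin n → Subset n
      class c = subsetOf (dec c)

    -- These sets are the unions of classes of `R`.
    Closed : PartialEquivalence → Subset n → Set
    Closed R S = S ⊆ V × (∀ {x y} → x ∈ S → x ~ y → y ∈ S)
      where open PartialEquivalence R

    Balanced : PartialEquivalence → Set
    Balanced R = ∃[ S ] Closed R S × 2 ℕ.* s ℕ.≤ card S × 2 ℕ.* s ℕ.≤ card (V ─ S)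

    Dominant : PartialEquivalence → Set
    Dominant R = ∃[ c ] card (V ─ class c) ℕ.≤ 4 ℕ.* s
      where open PartialEquivalence R

    co-closed : ∀ R {S} → Closed R S → Closed R (V ─ S)
    co-closed R {S} (S⊆V , S-closed) = p─q⊆p V S , λ x∈ x~y →
      x∈p∧x∉q⇒x∈p─q (~-dom (~-sym x~y)) λ y∈S → ∈─⇒∉ V S x∈ (S-closed y∈S (~-sym x~y))
      where open PartialEquivalence R

    -- Classes are added one at a time until their union first reaches 2s vertices. If at least 2s
    -- vertices of `V` remain, the union is balanced. Otherwise the class added last misses fewer
    -- than 2s vertices added before it and fewer than 2s never added.
    balanced⊎dominant : 2 ℕ.* s ℕ.≤ card V → ∀ R → Balanced R ⊎ Dominant R
    balanced⊎dominant 2s≤V R = finish (scan (allFin n))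
      where
      open PartialEquivalence R

      Meets : List (Fin n) → Fin n → Set
      Meets us x = Any (_~ x) us
      meets? : ∀ us → Decidable (Meets us)
      meets? us x = Any.any? (λ u → dec u x) us
      union : List (Fin n) → Subset n
      union us = subsetOf (meets? us)

      union-closed : ∀ us → Closed R (union us)
      union-closed us =
        (λ x∈ → dom us (∈-subsetOf⁻ (meets? us) x∈)) ,
        (λ x∈ x~y → ∈-subsetOf⁺ (meets? us)
          (Any.map (λ u~x → ~-trans u~x x~y) (∈-subsetOf⁻ (meets? us) x∈)))
        where
        dom : ∀ us {x} → Meets us x → x ∈ V
        dom (u ∷ us) (here u~x) = ~-dom (~-sym u~x)
        dom (u ∷ us) (there m) = dom us m

      scan : ∀ us → card (union us) ℕ.< 2 ℕ.* s ⊎ (Balanced R ⊎ Dominant R)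
      scan [] = inj₁ (ℕₚ.≤-<-trans
        (p⊆q⇒∣p∣≤∣q∣ {q = ∅} (λ x∈ → ⊥-elim (none (∈-subsetOf⁻ (meets? []) x∈))))
        (subst (ℕ._< 2 ℕ.* s) (sym (∣⊥∣≡0 n)) 0<2s))
        where
        none : ∀ {x} → ¬ Meets [] x
        none ()
        0<2s : 0 ℕ.< 2 ℕ.* s
        0<2s = ℕₚ.≤-trans 0<s (ℕₚ.m≤m+n s _)
      scan (u ∷ us) with scan us
      ... | inj₂ found = inj₂ found
      ... | inj₁ small with card (union (u ∷ us)) ℕ.<? 2 ℕ.* s
      ...   | yes small′ = inj₁ small′
      ...   | no large with 2 ℕ.* s ℕ.≤? card (V ─ union (u ∷ us))
      ...     | yes coLarge =
        inj₂ (inj₁ (union (u ∷ us) , union-closed (u ∷ us) , ℕₚ.≮⇒≥ large , coLarge))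
      ...     | no coSmall = inj₂ (inj₂ (u , (begin
        card (V ─ class u)
          ≤⟨ card-cover (V ─ class u) (V ─ union (u ∷ us)) (union us) cover ⟩
        card (V ─ union (u ∷ us)) ℕ.+ card (union us)
          ≤⟨ ℕₚ.+-mono-≤ (ℕₚ.<⇒≤ (ℕₚ.≰⇒> coSmall)) (ℕₚ.<⇒≤ small) ⟩
        2 ℕ.* s ℕ.+ 2 ℕ.* s
          ≡⟨ ℕₚ.*-distribʳ-+ s 2 2 ⟨
        4 ℕ.* s ∎)))
        where
        open ℕₚ.≤-Reasoning
        cover : ∀ {x} → x ∈ V ─ class u → x ∈ V ─ union (u ∷ us) ⊎ x ∈ union us
        cover {x} x∈ with meets? us x
        ... | yes m = inj₂ (∈-subsetOf⁺ (meets? us) m)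
        ... | no ¬m = inj₁ (x∈p∧x∉q⇒x∈p─q (p─q⊆p V _ x∈)
          λ x∈u → case (∈-subsetOf⁻ (meets? (u ∷ us)) x∈u))
          where
          case : Meets (u ∷ us) x → ⊥
          case (here u~x) = ∈─⇒∉ V (class u) x∈ (∈-subsetOf⁺ (dec u) u~x)
          case (there m) = ¬m m

      finish : card (union (allFin n)) ℕ.< 2 ℕ.* s ⊎ (Balanced R ⊎ Dominant R) →
        Balanced R ⊎ Dominant R
      finish (inj₂ found) = found
      -- Once every vertex has been scanned, reflexivity on `V` puts all of `V` into the union,
      -- which therefore cannot still be small.
      finish (inj₁ small) = ⊥-elim (ℕₚ.<⇒≱ small (ℕₚ.≤-trans 2s≤V
        (p⊆q⇒∣p∣≤∣q∣ λ x∈ → ∈-subsetOf⁺ (meets? (allFin n))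
          (Any.map (λ { refl → ~-refl x∈ }) (∈-allFin _)))))

    module _ (R K : PartialEquivalence) where

      private
        module R = PartialEquivalence R
        module K = PartialEquivalence K

      EdgeRelated : Set
      EdgeRelated = ∀ {x y} → x ∈ V → y ∈ V → Adj x y → x R.~ y ⊎ x K.~ y

      -- An edge leaving `S ∩ T` stays in `S` if it follows `R` and in `T` if it follows `K`, so it
      -- never reaches the opposite quadrant.
      ¬opposite-large : EdgeRelated → ∀ {S T} → Closed R S → Closed K T →
        s ℕ.≤ card (S ∩ T) → s ℕ.≤ card ((V ─ S) ─ T) → ⊥
      ¬opposite-large edge-related {S} {T} (S⊆V , S-closed) (T⊆V , T-closed) s≤ST s≤rest =
        joined (S ∩ T) ((V ─ S) ─ T)
          (((λ x x∈ x∈rest → ∉T x∈rest (p∩q⊆q S T x∈)) , s≤ST , s≤rest) , no-edge)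
        where
        ∉T : ∀ {x} → x ∈ (V ─ S) ─ T → x ∉ T
        ∉T = ∈─⇒∉ (V ─ S) T
        ∉S : ∀ {x} → x ∈ (V ─ S) ─ T → x ∉ S
        ∉S x∈ = ∈─⇒∉ V S (p─q⊆p (V ─ S) T x∈)
        no-edge : ∀ a b → a ∈ S ∩ T → b ∈ (V ─ S) ─ T → ¬ Adj a b
        no-edge a b a∈ b∈ ab
          with edge-related (S⊆V (p∩q⊆p S T a∈)) (p─q⊆p V S (p─q⊆p (V ─ S) T b∈)) ab
        ... | inj₁ aRb = ∉S b∈ (S-closed (p∩q⊆p S T a∈) aRb)
        ... | inj₂ aKb = ∉T b∈ (T-closed (p∩q⊆q S T a∈) aKb)

      -- The sets `S` and `T` cut `V` into four quadrants. If one quadrant has fewer than `s`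
      -- vertices, both quadrants next to it have at least `s`, since each of the four sides has at
      -- least 2s. These two are opposite, so some pair of opposite quadrants is always large.
      ¬both-balanced : EdgeRelated → Balanced R → Balanced K → ⊥
      ¬both-balanced edge-related
        (S , S-cl@(S⊆V , _) , 2s≤S , 2s≤Sᶜ) (T , T-cl@(T⊆V , T-closed) , 2s≤T , 2s≤Tᶜ)
        with s ℕ.≤? card (S ∩ T) | s ℕ.≤? card ((V ─ S) ─ T)
      ... | yes s≤ST | yes s≤rest = ¬opposite-large edge-related S-cl T-cl s≤ST s≤rest
      -- With `V ─ T` in the place of `T`, the opposite quadrants are `S ∩ (V ─ T)` and
      -- `(V ─ S) ─ (V ─ T)`; the latter is `T` without `S`.
      ... | no small | _ = ¬opposite-large edge-related S-cl (co-closed K T-cl)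
          (half S (S ∩ T) (S ∩ (V ─ T)) small 2s≤S by-T)
          (half T (S ∩ T) ((V ─ S) ─ (V ─ T)) small 2s≤T by-S)
        where
        by-T : ∀ {x} → x ∈ S → x ∈ S ∩ T ⊎ x ∈ S ∩ (V ─ T)
        by-T {x} x∈S with x ∈? T
        ... | yes x∈T = inj₁ (x∈p∩q⁺ (x∈S , x∈T))
        ... | no x∉T = inj₂ (x∈p∩q⁺ (x∈S , x∈p∧x∉q⇒x∈p─q (S⊆V x∈S) x∉T))
        by-S : ∀ {x} → x ∈ T → x ∈ S ∩ T ⊎ x ∈ (V ─ S) ─ (V ─ T)
        by-S {x} x∈T with x ∈? S
        ... | yes x∈S = inj₁ (x∈p∩q⁺ (x∈S , x∈T))
        ... | no x∉S = inj₂ (x∈p∧x∉q⇒x∈p─q (x∈p∧x∉q⇒x∈p─q (T⊆V x∈T) x∉S) λ x∈ → ∈─⇒∉ V T x∈ x∈T)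
      ... | yes _ | no small = ¬opposite-large edge-related S-cl (co-closed K T-cl)
          (half (V ─ T) ((V ─ S) ─ T) (S ∩ (V ─ T)) small 2s≤Tᶜ by-S)
          (half (V ─ S) ((V ─ S) ─ T) ((V ─ S) ─ (V ─ T)) small 2s≤Sᶜ by-T)
        where
        by-S : ∀ {x} → x ∈ V ─ T → x ∈ (V ─ S) ─ T ⊎ x ∈ S ∩ (V ─ T)
        by-S {x} x∈ with x ∈? S
        ... | yes x∈S = inj₂ (x∈p∩q⁺ (x∈S , x∈))
        ... | no x∉S = inj₁ (x∈p∧x∉q⇒x∈p─q (x∈p∧x∉q⇒x∈p─q (p─q⊆p V T x∈) x∉S) (∈─⇒∉ V T x∈))
        by-T : ∀ {x} → x ∈ V ─ S → x ∈ (V ─ S) ─ T ⊎ x ∈ (V ─ S) ─ (V ─ T)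
        by-T {x} x∈ with x ∈? T
        ... | yes x∈T = inj₂ (x∈p∧x∉q⇒x∈p─q x∈ λ x∈V─T → ∈─⇒∉ V T x∈V─T x∈T)
        ... | no x∉T = inj₁ (x∈p∧x∉q⇒x∈p─q x∈ x∉T)

  -- From a dominant class to a single class

  module _ {W : Subset n} (loose-W : Loose Adj W) (W<s : card W ℕ.< s)
    (largest : ∀ {X} → Loose Adj X × card X ℕ.< s → card X ℕ.≤ card W) where

    open Classes (∁ W)

    module _ (R K : PartialEquivalence) where

      private
        module R = PartialEquivalence R
        module K = PartialEquivalence K

      -- The complement `X` of the dominant class `ρ` has at most s + 4s vertices, which is the
      -- range of `loose⇒small`. Once `X` is known to be loose, maximality of `W` leaves no vertex
      -- of `∁ W` outside `ρ`.
      dominant⇒total : EdgeRelated R K → (∀ {x y} → x R.~ y → x K.~ y → x ≡ y) →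
        Dominant R → ∀ {x y} → x ∈ ∁ W → y ∈ ∁ W → x R.~ y
      dominant⇒total edge-related distinct (c , V─ρ≤4s) x∈ y∈ =
        R.~-trans (R.~-sym (in-ρ⇒ (V⊆ρ x∈))) (in-ρ⇒ (V⊆ρ y∈))
        where
        ρ X : Subset n
        ρ = R.class c
        X = ∁ ρ
        in-ρ⇒ : ∀ {x} → x ∈ ρ → c R.~ x
        in-ρ⇒ = ∈-subsetOf⁻ (R.dec c)
        ρ⊆V : ∀ {x} → x ∈ ρ → x ∈ ∁ W
        ρ⊆V x∈ = R.~-dom (R.~-sym (in-ρ⇒ x∈))
        loose-X : Loose Adj X
        loose-X w x y w∈X x∉X y∉X wx wy with w ∈? W
        -- Since `ρ` lies outside `W`, looseness of `W` handles the vertices of `W`.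
        ... | yes w∈W = loose-W w x y w∈W (out x∉X) (out y∉X) wx wy
          where
          out : ∀ {x} → x ∉ X → x ∉ W
          out x∉X = x∈∁p⇒x∉p (ρ⊆V (x∉∁p⇒x∈p x∉X))
        -- A vertex of `∁ W` outside `ρ` reaches `ρ` only along `K`, so its two neighbours in `ρ`
        -- are related by both `R` and `K`.
        ... | no w∉W = distinct
            (R.~-trans (R.~-sym (in-ρ⇒ x∈ρ)) (in-ρ⇒ y∈ρ))
            (K.~-trans (K.~-sym (column x∈ρ wx)) (column y∈ρ wy))
          where
          x∈ρ : x ∈ ρ
          x∈ρ = x∉∁p⇒x∈p x∉X
          y∈ρ : y ∈ ρ
          y∈ρ = x∉∁p⇒x∈p y∉X
          column : ∀ {z} → z ∈ ρ → Adj w z → w K.~ z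
          column z∈ρ wz with edge-related (x∉p⇒x∈∁p w∉W) (ρ⊆V z∈ρ) wz
          ... | inj₂ wKz = wKz
          ... | inj₁ wRz = ⊥-elim (x∈∁p⇒x∉p w∈X
                  (∈-subsetOf⁺ (R.dec c) (R.~-trans (in-ρ⇒ z∈ρ) (R.~-sym wRz))))
        cover : ∀ {x} → x ∈ X → x ∈ W ⊎ x ∈ ∁ W ─ ρ
        cover {x} x∈X with x ∈? W
        ... | yes x∈W = inj₁ x∈W
        ... | no x∉W = inj₂ (x∈p∧x∉q⇒x∈p─q (x∉p⇒x∈∁p x∉W) (x∈∁p⇒x∉p x∈X))
        X<s : card X ℕ.< s
        X<s = loose⇒small loose-X (ℕₚ.≤-trans (card-cover X W (∁ W ─ ρ) cover)
          (ℕₚ.+-mono-≤ (ℕₚ.<⇒≤ W<s) V─ρ≤4s))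
        V⊆ρ : ∀ {x} → x ∈ ∁ W → x ∈ ρ
        V⊆ρ {x} x∈V with x ∈? ρ
        ... | yes x∈ρ = x∈ρ
        -- Such an `x` makes the inclusion of `W` in `X` strict.
        ... | no x∉ρ = ⊥-elim (ℕₚ.<⇒≱
          (p⊂q⇒∣p∣<∣q∣ {p = W} {q = X}
            ((λ w∈W → x∉p⇒x∈∁p λ w∈ρ → x∈∁p⇒x∉p (ρ⊆V w∈ρ) w∈W) , x , x∉p⇒x∈∁p x∉ρ , x∈∁p⇒x∉p x∈V))
          (largest (loose-X , X<s)))

    module _ (R K : PartialEquivalence) where

      private
        module R = PartialEquivalence R
        module K = PartialEquivalence K

      -- By `¬both-balanced` one of the two relations has a dominant class. The hypotheses are
      -- symmetric in `R` and `K`, so `dominant⇒total` covers both cases.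
      one-line : EdgeRelated R K → (∀ {x y} → x R.~ y → x K.~ y → x ≡ y) →
        ∀ {x y} → x ∈ ∁ W → y ∈ ∁ W → x R.~ y ⊎ x K.~ y
      one-line edge-related distinct x∈ y∈
        with balanced⊎dominant 2s≤V R | balanced⊎dominant 2s≤V K
        where
        2s≤V : 2 ℕ.* s ℕ.≤ card (∁ W)
        2s≤V = subst (2 ℕ.* s ℕ.≤_) (sym (∣∁p∣≡n∸∣p∣ W)) (ℕₚ.m+n≤o⇒m≤o∸n (2 ℕ.* s) (begin
          2 ℕ.* s ℕ.+ card W  ≤⟨ ℕₚ.+-monoʳ-≤ (2 ℕ.* s) (ℕₚ.≤-trans (ℕₚ.<⇒≤ W<s) (ℕₚ.m≤m+n s _)) ⟩
          2 ℕ.* s ℕ.+ 9 ℕ.* s ≡⟨ ℕₚ.*-distribʳ-+ s 2 9 ⟨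
          11 ℕ.* s            ≤⟨ 11s≤n ⟩
          n                   ∎))
          where open ℕₚ.≤-Reasoning
      ... | inj₂ dominant | _ = inj₁ (dominant⇒total R K edge-related distinct dominant x∈ y∈)
      ... | _ | inj₂ dominant = inj₂ (dominant⇒total K R
              (λ x∈ y∈ → Sum.swap ∘ edge-related x∈ y∈) (λ k r → distinct r k) dominant x∈ y∈)
      ... | inj₁ balanced | inj₁ balanced′ =
              ⊥-elim (¬both-balanced R K edge-related balanced balanced′)

-- Null sequences

0<½* : ∀ {ε} → 0ℚ ℚ.< ε → 0ℚ ℚ.< ½ ℚ.* ε
0<½* {ε} 0<ε = subst (ℚ._< ½ ℚ.* ε) (ℚₚ.*-zeroʳ ½) (ℚₚ.*-monoʳ-<-pos ½ 0<ε)

halves : ∀ ε → ½ ℚ.* ε ℚ.+ ½ ℚ.* ε ≡ ε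
halves = solve 1 (λ e → con ½ :* e :+ con ½ :* e := e) refl

∣∣-≤ : ∀ a b → ℚ.∣ a ∣ ℚ.≤ ℚ.∣ b ∣ ℚ.+ ℚ.∣ b ℚ.- a ∣
∣∣-≤ a b = subst (λ t → ℚ.∣ t ∣ ℚ.≤ ℚ.∣ b ∣ ℚ.+ ℚ.∣ b ℚ.- a ∣)
  (solve 2 (λ a b → b :- (b :- a) := a) refl a b) (ℚₚ.∣p-q∣≤∣p∣+∣q∣ b (b ℚ.- a))

-- `x ≈ y` unfolds to `Null (seq (x - y))`, so facts about null sequences apply to equality of reals
-- without conversion.
Null : (ℕ → ℚ) → Set
Null z = ∀ ε → 0ℚ ℚ.< ε → ∃[ N ] (∀ n → N ℕ.≤ n → ℚ.∣ z n ∣ ℚ.≤ ε)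

-- This is constructive apartness from zero.
AwayFromZero : (ℕ → ℚ) → Set
AwayFromZero z = ∃[ ε ] (0ℚ ℚ.< ε × ∃[ N ] (∀ n → N ℕ.≤ n → ε ℚ.≤ ℚ.∣ z n ∣))

-- Let `N` be a Cauchy modulus for ε/2. Comparing the single rational `∣ z N ∣` with ε/2 is
-- decidable: a small value bounds the whole tail by ε, a large one keeps the tail away from zero by
-- its excess.
¬away⇒null : ∀ {z} → IsCauchy z → ¬ AwayFromZero z → Null z
¬away⇒null {z} cauchy ¬away ε 0<ε with cauchy (½ ℚ.* ε) (0<½* 0<ε)
... | N , near with ℚ.∣ z N ∣ ℚₚ.≤? ½ ℚ.* ε
...   | yes small = N , λ n N≤n → begin
        ℚ.∣ z n ∣                      ≤⟨ ∣∣-≤ (z n) (z N) ⟩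
        ℚ.∣ z N ∣ ℚ.+ ℚ.∣ z N ℚ.- z n ∣ ≤⟨ ℚₚ.+-mono-≤ small (near N n ℕₚ.≤-refl N≤n) ⟩
        ½ ℚ.* ε ℚ.+ ½ ℚ.* ε            ≡⟨ halves ε ⟩
        ε                              ∎
        where open ℚₚ.≤-Reasoning
...   | no large = ⊥-elim (¬away (ℚ.∣ z N ∣ ℚ.- ½ ℚ.* ε , 0<gap , N , λ n N≤n → begin
        ℚ.∣ z N ∣ ℚ.- ½ ℚ.* ε
          ≤⟨ ℚₚ.+-monoˡ-≤ (ℚ.- (½ ℚ.* ε)) (∣∣-≤ (z N) (z n)) ⟩
        ℚ.∣ z n ∣ ℚ.+ ℚ.∣ z n ℚ.- z N ∣ ℚ.- ½ ℚ.* ε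
          ≤⟨ ℚₚ.+-monoˡ-≤ (ℚ.- (½ ℚ.* ε)) (ℚₚ.+-monoʳ-≤ ℚ.∣ z n ∣ (near n N N≤n ℕₚ.≤-refl)) ⟩
        ℚ.∣ z n ∣ ℚ.+ ½ ℚ.* ε ℚ.- ½ ℚ.* ε
          ≡⟨ solve 2 (λ a b → a :+ b :- b := a) refl ℚ.∣ z n ∣ (½ ℚ.* ε) ⟩
        ℚ.∣ z n ∣ ∎))
        where
        open ℚₚ.≤-Reasoning
        0<gap : 0ℚ ℚ.< ℚ.∣ z N ∣ ℚ.- ½ ℚ.* ε
        0<gap = subst (ℚ._< ℚ.∣ z N ∣ ℚ.- ½ ℚ.* ε) (ℚₚ.+-inverseʳ (½ ℚ.* ε))
          (ℚₚ.+-monoˡ-< (ℚ.- (½ ℚ.* ε)) (ℚₚ.≰⇒> large))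

null⇒¬away : ∀ {z} → Null z → ¬ AwayFromZero z
null⇒¬away {z} null (ε , 0<ε , M , away) with null (½ ℚ.* ε) (0<½* 0<ε)
... | N , small = ℚₚ.<-irrefl refl (begin-strict
  ε                 ≤⟨ away (M ⊔ N) (ℕₚ.m≤m⊔n M N) ⟩
  ℚ.∣ z (M ⊔ N) ∣   ≤⟨ small (M ⊔ N) (ℕₚ.m≤n⊔m M N) ⟩
  ½ ℚ.* ε           ≡⟨ ℚₚ.+-identityʳ (½ ℚ.* ε) ⟨
  ½ ℚ.* ε ℚ.+ 0ℚ    <⟨ ℚₚ.+-monoʳ-< (½ ℚ.* ε) (0<½* 0<ε) ⟩
  ½ ℚ.* ε ℚ.+ ½ ℚ.* ε ≡⟨ halves ε ⟩
  ε                 ∎)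
  where open ℚₚ.≤-Reasoning

null-dominated : ∀ {z w : ℕ → ℚ} → (∀ n → ℚ.∣ w n ∣ ℚ.≤ ℚ.∣ z n ∣) → Null z → Null w
null-dominated w≤z null ε 0<ε with null ε 0<ε
... | N , small = N , λ n N≤n → ℚₚ.≤-trans (w≤z n) (small n N≤n)

null-cong : ∀ {z w : ℕ → ℚ} → (∀ n → w n ≡ z n) → Null z → Null w
null-cong w≡z = null-dominated λ n → ℚₚ.≤-reflexive (cong ℚ.∣_∣ (w≡z n))

null-zero : ∀ {z : ℕ → ℚ} → (∀ n → z n ≡ 0ℚ) → Null z
null-zero z≡0 ε 0<ε = 0 , λ n _ →
  subst (λ t → ℚ.∣ t ∣ ℚ.≤ ε) (sym (z≡0 n)) (ℚₚ.<⇒≤ 0<ε)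

null-neg-cong : ∀ {z w : ℕ → ℚ} → (∀ n → w n ≡ ℚ.- z n) → Null z → Null w
null-neg-cong {z} w≡-z = null-dominated λ n →
  ℚₚ.≤-reflexive (trans (cong ℚ.∣_∣ (w≡-z n)) (ℚₚ.∣-p∣≡∣p∣ (z n)))

null-+ : ∀ {z w : ℕ → ℚ} → Null z → Null w → Null (λ n → z n ℚ.+ w n)
null-+ {z} {w} nz nw ε 0<ε with nz (½ ℚ.* ε) (0<½* 0<ε) | nw (½ ℚ.* ε) (0<½* 0<ε)
... | M , smallz | N , smallw = M ⊔ N , λ n le → begin
  ℚ.∣ z n ℚ.+ w n ∣         ≤⟨ ℚₚ.∣p+q∣≤∣p∣+∣q∣ (z n) (w n) ⟩
  ℚ.∣ z n ∣ ℚ.+ ℚ.∣ w n ∣   ≤⟨ ℚₚ.+-mono-≤ (smallz n (ℕₚ.m⊔n≤o⇒m≤o M N le))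
                                              (smallw n (ℕₚ.m⊔n≤o⇒n≤o M N le)) ⟩
  ½ ℚ.* ε ℚ.+ ½ ℚ.* ε       ≡⟨ halves ε ⟩
  ε                         ∎
  where open ℚₚ.≤-Reasoning

null-half : ∀ {z : ℕ → ℚ} → Null (λ n → z n ℚ.+ z n) → Null z
null-half {z} = null-dominated λ n → begin
  ℚ.∣ z n ∣
    ≡⟨ ℚₚ.+-identityʳ ℚ.∣ z n ∣ ⟨
  ℚ.∣ z n ∣ ℚ.+ 0ℚ
    ≤⟨ ℚₚ.+-monoʳ-≤ ℚ.∣ z n ∣ (ℚₚ.0≤∣p∣ (z n)) ⟩
  ℚ.∣ z n ∣ ℚ.+ ℚ.∣ z n ∣
    ≡⟨ solve 1 (λ a → a :+ a := (con 1ℚ :+ con 1ℚ) :* a) refl ℚ.∣ z n ∣ ⟩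
  (1ℚ ℚ.+ 1ℚ) ℚ.* ℚ.∣ z n ∣
    ≡⟨ ℚₚ.∣p*q∣≡∣p∣*∣q∣ (1ℚ ℚ.+ 1ℚ) (z n) ⟨
  ℚ.∣ (1ℚ ℚ.+ 1ℚ) ℚ.* z n ∣
    ≡⟨ cong ℚ.∣_∣ (solve 1 (λ a → (con 1ℚ :+ con 1ℚ) :* a := a :+ a) refl (z n)) ⟩
  ℚ.∣ z n ℚ.+ z n ∣ ∎
  where open ℚₚ.≤-Reasoning

-- Equal signs give the first alternative, opposite signs the second.
∣∣-∣∣-cases : ∀ a b → ℚ.∣ ℚ.∣ a ∣ ℚ.- ℚ.∣ b ∣ ∣ ≡ ℚ.∣ a ℚ.- b ∣
                    ⊎ ℚ.∣ ℚ.∣ a ∣ ℚ.- ℚ.∣ b ∣ ∣ ≡ ℚ.∣ a ℚ.- (ℚ.- b) ∣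
∣∣-∣∣-cases a b with ℚₚ.∣p∣≡p∨∣p∣≡-p a | ℚₚ.∣p∣≡p∨∣p∣≡-p b
... | inj₁ ea | inj₁ eb rewrite ea | eb = inj₁ refl
... | inj₁ ea | inj₂ eb rewrite ea | eb = inj₂ refl
... | inj₂ ea | inj₁ eb rewrite ea | eb = inj₂ (trans (sym (ℚₚ.∣-p∣≡∣p∣ (ℚ.- a ℚ.- b)))
  (cong ℚ.∣_∣ (solve 2 (λ a b → :- (:- a :- b) := a :- (:- b)) refl a b)))
... | inj₂ ea | inj₂ eb rewrite ea | eb = inj₁ (trans (sym (ℚₚ.∣-p∣≡∣p∣ (ℚ.- a ℚ.- (ℚ.- b))))
  (cong ℚ.∣_∣ (solve 2 (λ a b → :- (:- a :- (:- b)) := a :- b) refl a b)))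

∣a∣-∣b∣≤∣a-b∣ : ∀ a b → ℚ.∣ a ∣ ℚ.- ℚ.∣ b ∣ ℚ.≤ ℚ.∣ a ℚ.- b ∣
∣a∣-∣b∣≤∣a-b∣ a b = begin
  ℚ.∣ a ∣ ℚ.- ℚ.∣ b ∣
    ≡⟨ cong (λ t → ℚ.∣ t ∣ ℚ.- ℚ.∣ b ∣) (solve 2 (λ a b → a := (a :- b) :+ b) refl a b) ⟩
  ℚ.∣ (a ℚ.- b) ℚ.+ b ∣ ℚ.- ℚ.∣ b ∣
    ≤⟨ ℚₚ.+-monoˡ-≤ (ℚ.- ℚ.∣ b ∣) (ℚₚ.∣p+q∣≤∣p∣+∣q∣ (a ℚ.- b) b) ⟩
  ℚ.∣ a ℚ.- b ∣ ℚ.+ ℚ.∣ b ∣ ℚ.- ℚ.∣ b ∣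
    ≡⟨ solve 2 (λ x y → x :+ y :- y := x) refl ℚ.∣ a ℚ.- b ∣ ℚ.∣ b ∣ ⟩
  ℚ.∣ a ℚ.- b ∣ ∎
  where open ℚₚ.≤-Reasoning

∣p-q∣≡∣q-p∣ : ∀ p q → ℚ.∣ p ℚ.- q ∣ ≡ ℚ.∣ q ℚ.- p ∣
∣p-q∣≡∣q-p∣ p q = trans (sym (ℚₚ.∣-p∣≡∣p∣ (p ℚ.- q)))
  (cong ℚ.∣_∣ (solve 2 (λ p q → :- (p :- q) := q :- p) refl p q))

reverse-triangle : ∀ a b → ℚ.∣ ℚ.∣ a ∣ ℚ.- ℚ.∣ b ∣ ∣ ℚ.≤ ℚ.∣ a ℚ.- b ∣
reverse-triangle a b with ℚₚ.∣p∣≡p∨∣p∣≡-p (ℚ.∣ a ∣ ℚ.- ℚ.∣ b ∣)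
... | inj₁ e = subst (ℚ._≤ ℚ.∣ a ℚ.- b ∣) (sym e) (∣a∣-∣b∣≤∣a-b∣ a b)
... | inj₂ e = subst₂ ℚ._≤_
  (sym (trans e (solve 2 (λ x y → :- (x :- y) := y :- x) refl ℚ.∣ a ∣ ℚ.∣ b ∣)))
  (∣p-q∣≡∣q-p∣ b a) (∣a∣-∣b∣≤∣a-b∣ b a)

-- For Cauchy sequences, being null amounts to not being away from zero, and negations are stable.
≈-stable : ∀ x y → ¬ ¬ x ≈ y → x ≈ y
≈-stable x y ¬¬x≈y = ¬away⇒null (cauchy (x - y)) λ away →
  ¬¬x≈y λ x≈y → null⇒¬away x≈y away

≈⇒∣∣≈ : ∀ x y → x ≈ y → ∣ x ∣ ≈ ∣ y ∣
≈⇒∣∣≈ x y = null-dominated λ n → reverse-triangle (seq x n) (seq y n)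

≈-⇒∣∣≈ : ∀ x y → x ≈ - y → ∣ x ∣ ≈ ∣ y ∣
≈-⇒∣∣≈ x y x≈-y = null-cong
  (λ n → cong (λ t → ℚ.∣ seq x n ∣ ℚ.- t) (sym (ℚₚ.∣-p∣≡∣p∣ (seq y n))))
  (≈⇒∣∣≈ x (- y) x≈-y)

-- The sign cannot be decided for Cauchy reals, hence the double negation. If both alternatives
-- failed, `x - y` and `x + y` would be away from zero, and so would the difference of the absolute
-- values, by the smaller of the two margins.
∣∣≈⇒¬¬≈± : ∀ x y → ∣ x ∣ ≈ ∣ y ∣ → ¬ ¬ (x ≈ y ⊎ x ≈ - y)
∣∣≈⇒¬¬≈± x y ∣x∣≈∣y∣ neither =
  neither (inj₁ (¬away⇒null (cauchy (x - y)) λ away₁ →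
    neither (inj₂ (¬away⇒null (cauchy (x - (- y))) λ away₂ → ¬both-away away₁ away₂))))
  where
  ¬both-away : AwayFromZero (seq (x - y)) → AwayFromZero (seq (x - (- y))) → ⊥
  ¬both-away (ε₁ , 0<ε₁ , N₁ , away₁) (ε₂ , 0<ε₂ , N₂ , away₂) =
    null⇒¬away ∣x∣≈∣y∣ (ε₁ ℚ.⊓ ε₂ , 0<⊓ , N₁ ⊔ N₂ , λ n le → away n
      (away₁ n (ℕₚ.m⊔n≤o⇒m≤o N₁ N₂ le)) (away₂ n (ℕₚ.m⊔n≤o⇒n≤o N₁ N₂ le)))
    where
    0<⊓ : 0ℚ ℚ.< ε₁ ℚ.⊓ ε₂
    0<⊓ with ℚₚ.⊓-sel ε₁ ε₂
    ... | inj₁ e = subst (0ℚ ℚ.<_) (sym e) 0<ε₁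
    ... | inj₂ e = subst (0ℚ ℚ.<_) (sym e) 0<ε₂
    away : ∀ n → ε₁ ℚ.≤ ℚ.∣ seq x n ℚ.- seq y n ∣ → ε₂ ℚ.≤ ℚ.∣ seq x n ℚ.- (ℚ.- seq y n) ∣ →
      ε₁ ℚ.⊓ ε₂ ℚ.≤ ℚ.∣ ℚ.∣ seq x n ∣ ℚ.- ℚ.∣ seq y n ∣ ∣
    away n a₁ a₂ with ∣∣-∣∣-cases (seq x n) (seq y n)
    ... | inj₁ e = subst (ε₁ ℚ.⊓ ε₂ ℚ.≤_) (sym e) (ℚₚ.≤-trans (ℚₚ.p⊓q≤p ε₁ ε₂) a₁)
    ... | inj₂ e = subst (ε₁ ℚ.⊓ ε₂ ℚ.≤_) (sym e) (ℚₚ.≤-trans (ℚₚ.p⊓q≤q ε₁ ε₂) a₂)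

-- Rigidity

-- Rows and columns need not be decidable, but the conclusion of rigidity is ¬¬-stable, so finitely
-- many instances of excluded middle may be assumed in its proof.
¬¬-∀ : ∀ {n} {P : Fin n → Set} → (∀ i → ¬ ¬ P i) → ¬ ¬ (∀ i → P i)
¬¬-∀ {zero} _ k = k λ ()
¬¬-∀ {suc n} ¬¬P k = ¬¬P zero λ p₀ → ¬¬-∀ (¬¬P ∘ suc) λ ps →
  k λ { zero → p₀ ; (suc i) → ps i }

¬¬-dec : ∀ {n} (P : Fin n → Fin n → Set) → ¬ ¬ Decidable₂ P
¬¬-dec P = ¬¬-∀ λ i → ¬¬-∀ λ j → ¬¬-excluded-middle

module _ {n} (G : SimpleGraph (Fin n)) (adj? : Decidable₂ (Adj G))
  (s : ℕ) (0<s : 0 ℕ.< s) (11s≤n : 11 ℕ.* s ℕ.≤ n) (joined : Joined (Adj G) s) where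

  open Expansion adj? (Adj-sym G) s 0<s 11s≤n joined

  rigid-core : ∃[ V ] n ℕ.≤ card V ℕ.+ s × GloballyRigid (induced G V)
  rigid-core with core
  ... | W , (loose-W , W<s) , largest = ∁ W , large , rigid
    where
    open Classes (∁ W)
    large : n ℕ.≤ card (∁ W) ℕ.+ s
    large = begin
      n                               ≡⟨ ℕₚ.m+[n∸m]≡n (∣p∣≤n W) ⟨
      card W ℕ.+ (n ℕ.∸ card W)       ≡⟨ cong (card W ℕ.+_) (∣∁p∣≡n∸∣p∣ W) ⟨
      card W ℕ.+ card (∁ W)           ≡⟨ ℕₚ.+-comm (card W) _ ⟩
      card (∁ W) ℕ.+ card W           ≤⟨ ℕₚ.+-monoʳ-≤ (card (∁ W)) (ℕₚ.<⇒≤ W<s) ⟩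
      card (∁ W) ℕ.+ s                ∎
      where open ℕₚ.≤-Reasoning

    V : Set
    V = ∃[ i ] i ∈ ∁ W

    module _ (_∼_ : V → V → Set) where
      Lifted : Fin n → Fin n → Set
      Lifted i j = Σ (i ∈ ∁ W) λ p → Σ (j ∈ ∁ W) λ q → (i , p) ∼ (j , q)

      -- Proofs of membership in `∁ W` are unique, so those packed into `Lifted` may be exchanged
      -- for any others.
      lower : ∀ {i j p q} → Lifted i j → (i , p) ∼ (j , q)
      lower {p = p} {q} (p′ , q′ , r)
        rewrite []=-irrelevant p p′ | []=-irrelevant q q′ = r

      lift : Reflexive _∼_ → Symmetric _∼_ → Transitive _∼_ → Decidable₂ Lifted →
        PartialEquivalence
      lift ∼-refl ∼-sym ∼-trans dec = record
        { _~_     = Lifted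
        ; dec     = dec
        ; ~-sym   = λ (p , q , r) → q , p , ∼-sym r
        ; ~-trans = λ (p , q , r) t@(_ , q″ , _) → p , q″ , ∼-trans r (lower t)
        ; ~-refl  = λ p → p , p , ∼-refl
        ; ~-dom   = proj₁
        }

    rigid : GloballyRigid (induced G (∁ W))
    rigid f g f-inj g-inj iso x@(i , p) y@(j , q) =
      ≈-stable ∣ f x - f y ∣ ∣ g x - g y ∣ λ ¬goal →
      ¬¬-dec (Lifted Row) λ row? → ¬¬-dec (Lifted Col) λ col? →
      ¬¬-∀ (λ a → ¬¬-∀ λ b → edge-split a b) λ edges →
      [ (λ r → ¬goal (≈⇒∣∣≈ (f x - f y) (g x - g y) (lower Row r)))
      , (λ c → ¬goal (≈-⇒∣∣≈ (f x - f y) (g x - g y) (lower Col c))) ]′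
      (one-line loose-W W<s largest
        (lift Row (λ {x} → row-refl {x}) (λ {x} {y} → row-sym {x} {y})
          (λ {x} {y} {z} → row-trans {x} {y} {z}) row?)
        (lift Col (λ {x} → col-refl {x}) (λ {x} {y} → col-sym {x} {y})
          (λ {x} {y} {z} → col-trans {x} {y} {z}) col?)
        (edges _ _) distinct p q)
      where
      Row Col : V → V → Set
      -- `Row` says that `f - g` agrees at the two vertices, `Col` that `f + g` does; the form
      -- chosen matches the two signs in `∣∣≈⇒¬¬≈±`.
      Row x y = f x - f y ≈ g x - g y
      Col x y = f x - f y ≈ - (g x - g y)
      row-refl : Reflexive Row
      row-refl {x} = null-zero λ n →
        solve 2 (λ a c → (a :- a) :- (c :- c) := con 0ℚ) refl (seq (f x) n) (seq (g x) n)
      col-refl : Reflexive Col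
      col-refl {x} = null-zero λ n →
        solve 2 (λ a c → (a :- a) :- (:- (c :- c)) := con 0ℚ) refl (seq (f x) n) (seq (g x) n)
      row-sym : Symmetric Row
      row-sym {x} {y} = null-neg-cong λ n →
        solve 4 (λ a b c d → (b :- a) :- (d :- c) := :- ((a :- b) :- (c :- d))) refl
          (seq (f x) n) (seq (f y) n) (seq (g x) n) (seq (g y) n)
      col-sym : Symmetric Col
      col-sym {x} {y} = null-neg-cong λ n →
        solve 4 (λ a b c d → (b :- a) :- (:- (d :- c)) := :- ((a :- b) :- (:- (c :- d)))) refl
          (seq (f x) n) (seq (f y) n) (seq (g x) n) (seq (g y) n)
      row-trans : Transitive Row
      row-trans {x} {y} {z} r r′ = null-cong
        (λ n → solve 6 (λ a b c a′ b′ c′ →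
            (a :- c) :- (a′ :- c′) := ((a :- b) :- (a′ :- b′)) :+ ((b :- c) :- (b′ :- c′))) refl
          (seq (f x) n) (seq (f y) n) (seq (f z) n) (seq (g x) n) (seq (g y) n) (seq (g z) n))
        (null-+ r r′)
      col-trans : Transitive Col
      col-trans {x} {y} {z} r r′ = null-cong
        (λ n → solve 6 (λ a b c a′ b′ c′ →
            (a :- c) :- (:- (a′ :- c′)) :=
            ((a :- b) :- (:- (a′ :- b′))) :+ ((b :- c) :- (:- (b′ :- c′)))) refl
          (seq (f x) n) (seq (f y) n) (seq (f z) n) (seq (g x) n) (seq (g y) n) (seq (g z) n))
        (null-+ r r′)
      -- Adding the row and the column relation shows that twice the difference of the values of `f`
      -- is null, and `f` is injective.
      distinct : ∀ {a b} → Lifted Row a b → Lifted Col a b → a ≡ b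
      distinct {a} {b} (p , q , r) c = cong proj₁ (f-inj (null-half (null-cong
        (λ n → solve 4 (λ a b c d →
            (a :- b) :+ (a :- b) := ((a :- b) :- (c :- d)) :+ ((a :- b) :- (:- (c :- d)))) refl
          (seq (f (a , p)) n) (seq (f (b , q)) n) (seq (g (a , p)) n) (seq (g (b , q)) n))
        (null-+ r (lower Col c)))))
      -- Membership and adjacency are decidable, so only true edges inside `∁ W` remain, and there
      -- `iso` equates the absolute values.
      edge-split : ∀ a b → ¬ ¬ (a ∈ ∁ W → b ∈ ∁ W → Adj G a b → Lifted Row a b ⊎ Lifted Col a b)
      edge-split a b k with a ∈? ∁ W | b ∈? ∁ W | adj? a b
      ... | no a∉ | _ | _ = k λ a∈ → ⊥-elim (a∉ a∈)
      ... | yes _ | no b∉ | _ = k λ _ b∈ → ⊥-elim (b∉ b∈)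
      ... | yes _ | yes _ | no ¬ab = k λ _ _ ab → ⊥-elim (¬ab ab)
      ... | yes a∈ | yes b∈ | yes ab =
        ∣∣≈⇒¬¬≈± (f (a , a∈) - f (b , b∈)) (g (a , a∈) - g (b , b∈)) (iso ab) λ split →
        k λ _ _ _ → Sum.map (λ r → a∈ , b∈ , r) (λ c → a∈ , b∈ , c) split

-- Powers of rationals

0≤* : ∀ {p q} → 0ℚ ℚ.≤ p → 0ℚ ℚ.≤ q → 0ℚ ℚ.≤ p ℚ.* q
0≤* {p} {q} 0≤p 0≤q = subst (ℚ._≤ p ℚ.* q) (ℚₚ.*-zeroʳ p)
  (ℚₚ.*-monoˡ-≤-nonNeg p {{ℚ.nonNegative 0≤p}} 0≤q)

*-monoʳ-≤ : ∀ {r p q} → 0ℚ ℚ.≤ r → p ℚ.≤ q → r ℚ.* p ℚ.≤ r ℚ.* q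
*-monoʳ-≤ {r} 0≤r = ℚₚ.*-monoˡ-≤-nonNeg r {{ℚ.nonNegative 0≤r}}

0≤1 : 0ℚ ℚ.≤ 1ℚ
0≤1 = ℚₚ.nonNegative⁻¹ 1ℚ

^-nonneg : ∀ {q} → 0ℚ ℚ.≤ q → ∀ n → 0ℚ ℚ.≤ q ^ n
^-nonneg 0≤q zero = 0≤1
^-nonneg 0≤q (suc n) = 0≤* 0≤q (^-nonneg 0≤q n)

^-≤1 : ∀ {q} → 0ℚ ℚ.≤ q → q ℚ.≤ 1ℚ → ∀ n → q ^ n ℚ.≤ 1ℚ
^-≤1 0≤q q≤1 zero = ℚₚ.≤-refl
^-≤1 {q} 0≤q q≤1 (suc n) = begin
  q ℚ.* q ^ n   ≤⟨ *-monoʳ-≤ 0≤q (^-≤1 0≤q q≤1 n) ⟩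
  q ℚ.* 1ℚ      ≡⟨ ℚₚ.*-identityʳ q ⟩
  q             ≤⟨ q≤1 ⟩
  1ℚ            ∎
  where open ℚₚ.≤-Reasoning

^-antimono : ∀ {q} → 0ℚ ℚ.≤ q → q ℚ.≤ 1ℚ → ∀ {m n} → m ℕ.≤ n → q ^ n ℚ.≤ q ^ m
^-antimono {q} 0≤q q≤1 {m} {n} m≤n = begin
  q ^ n                       ≡⟨ cong (q ^_) (ℕₚ.m+[n∸m]≡n m≤n) ⟨
  q ^ (m ℕ.+ (n ℕ.∸ m))       ≡⟨ ^-homo-* q m (n ℕ.∸ m) ⟩
  q ^ m ℚ.* q ^ (n ℕ.∸ m)     ≤⟨ *-monoʳ-≤ (^-nonneg 0≤q m) (^-≤1 0≤q q≤1 (n ℕ.∸ m)) ⟩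
  q ^ m ℚ.* 1ℚ                ≡⟨ ℚₚ.*-identityʳ (q ^ m) ⟩
  q ^ m                       ∎
  where open ℚₚ.≤-Reasoning

*-monoˡ-≤ : ∀ {r p q} → 0ℚ ℚ.≤ r → p ℚ.≤ q → p ℚ.* r ℚ.≤ q ℚ.* r
*-monoˡ-≤ {r} 0≤r = ℚₚ.*-monoʳ-≤-nonNeg r {{ℚ.nonNegative 0≤r}}

-- Finite sums

module _ {A : Set} where

  sumOver : List A → (A → ℚ) → ℚ
  sumOver xs F = foldr (λ x acc → F x ℚ.+ acc) 0ℚ xs

  sum-cong : ∀ xs {F G : A → ℚ} → (∀ x → F x ≡ G x) → sumOver xs F ≡ sumOver xs G
  sum-cong [] F≡G = refl
  sum-cong (x ∷ xs) F≡G = cong₂ ℚ._+_ (F≡G x) (sum-cong xs F≡G)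

  sum-mono : ∀ xs {F G : A → ℚ} → (∀ x → F x ℚ.≤ G x) → sumOver xs F ℚ.≤ sumOver xs G
  sum-mono [] F≤G = ℚₚ.≤-refl
  sum-mono (x ∷ xs) F≤G = ℚₚ.+-mono-≤ (F≤G x) (sum-mono xs F≤G)

  sum-0 : ∀ xs → sumOver xs (const 0ℚ) ≡ 0ℚ
  sum-0 [] = refl
  sum-0 (x ∷ xs) = trans (ℚₚ.+-identityˡ _) (sum-0 xs)

  sum-nonneg : ∀ xs {F : A → ℚ} → (∀ x → 0ℚ ℚ.≤ F x) → 0ℚ ℚ.≤ sumOver xs F
  sum-nonneg xs {F} 0≤F = subst (ℚ._≤ sumOver xs F) (sum-0 xs) (sum-mono xs 0≤F)

  sum-+ : ∀ xs (F G : A → ℚ) →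
    sumOver xs (λ x → F x ℚ.+ G x) ≡ sumOver xs F ℚ.+ sumOver xs G
  sum-+ [] F G = refl
  sum-+ (x ∷ xs) F G = trans (cong (F x ℚ.+ G x ℚ.+_) (sum-+ xs F G))
    (solve 4 (λ a b c d → (a :+ b) :+ (c :+ d) := (a :+ c) :+ (b :+ d)) refl
      (F x) (G x) (sumOver xs F) (sumOver xs G))

  sum-* : ∀ xs c (F : A → ℚ) → sumOver xs (λ x → c ℚ.* F x) ≡ c ℚ.* sumOver xs F
  sum-* [] c F = sym (ℚₚ.*-zeroʳ c)
  sum-* (x ∷ xs) c F = trans (cong (c ℚ.* F x ℚ.+_) (sum-* xs c F))
    (sym (ℚₚ.*-distribˡ-+ c (F x) (sumOver xs F)))

  sum-++ : ∀ xs ys (F : A → ℚ) → sumOver (xs ++ ys) F ≡ sumOver xs F ℚ.+ sumOver ys F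
  sum-++ [] ys F = sym (ℚₚ.+-identityˡ _)
  sum-++ (x ∷ xs) ys F = trans (cong (F x ℚ.+_) (sum-++ xs ys F))
    (sym (ℚₚ.+-assoc (F x) (sumOver xs F) (sumOver ys F)))

sum-map : ∀ {A B : Set} xs (h : A → B) (F : B → ℚ) → sumOver (map h xs) F ≡ sumOver xs (F ∘ h)
sum-map [] h F = refl
sum-map (x ∷ xs) h F = cong (F (h x) ℚ.+_) (sum-map xs h F)

module _ {A B : Set} where

  sum-× : ∀ xs ys (F : A × B → ℚ) →
    sumOver (cartesianProduct xs ys) F ≡ sumOver xs (λ x → sumOver ys (λ y → F (x , y)))
  sum-× [] ys F = refl
  sum-× (x ∷ xs) ys F = trans (sum-++ (map (x ,_) ys) (cartesianProduct xs ys) F)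
    (cong₂ ℚ._+_ (sum-map ys (x ,_) F) (sum-× xs ys F))

  sum-swap : ∀ (xs : List A) (ys : List B) (F : A → B → ℚ) →
    sumOver xs (λ x → sumOver ys (F x)) ≡ sumOver ys (λ y → sumOver xs (λ x → F x y))
  sum-swap [] ys F = sym (sum-0 ys)
  sum-swap (x ∷ xs) ys F = trans (cong (sumOver ys (F x) ℚ.+_) (sum-swap xs ys F))
    (sym (sum-+ ys (F x) (λ y → sumOver xs (λ x → F x y))))

sum-allBits : ∀ m (F : Vec Bool (suc m) → ℚ) → sumOver (allBits (suc m)) F ≡
  sumOver (allBits m) (F ∘ (true ∷_)) ℚ.+ sumOver (allBits m) (F ∘ (false ∷_))
sum-allBits m F = trans (sum-++ (map (true ∷_) (allBits m)) (map (false ∷_) (allBits m)) F)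
  (cong₂ ℚ._+_ (sum-map (allBits m) (true ∷_) F) (sum-map (allBits m) (false ∷_) F))

2ℚ : ℚ
2ℚ = 1ℚ ℚ.+ 1ℚ

sum-allBits-const : ∀ m c → sumOver (allBits m) (const c) ≡ 2ℚ ^ m ℚ.* c
sum-allBits-const zero c = solve 1 (λ c → c :+ con 0ℚ := con 1ℚ :* c) refl c
sum-allBits-const (suc m) c = trans (sum-allBits m (const c))
  (trans (cong₂ ℚ._+_ (sum-allBits-const m c) (sum-allBits-const m c))
    (solve 2 (λ t c → t :* c :+ t :* c := ((con 1ℚ :+ con 1ℚ) :* t) :* c) refl (2ℚ ^ m) c))

≤sum-allBits : ∀ {m} (F : Vec Bool m → ℚ) → (∀ v → 0ℚ ℚ.≤ F v) →
  ∀ v → F v ℚ.≤ sumOver (allBits m) F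
≤sum-allBits F 0≤F [] = ℚₚ.≤-reflexive (sym (ℚₚ.+-identityʳ (F [])))
≤sum-allBits {suc m} F 0≤F (b ∷ v) = begin
  F (b ∷ v)                    ≤⟨ ≤sum-allBits (F ∘ (b ∷_)) (0≤F ∘ (b ∷_)) v ⟩
  S b                          ≤⟨ ≤total b ⟩
  S true ℚ.+ S false           ≡⟨ sum-allBits m F ⟨
  sumOver (allBits (suc m)) F  ∎
  where
  open ℚₚ.≤-Reasoning
  S : Bool → ℚ
  S b = sumOver (allBits m) (F ∘ (b ∷_))
  0≤S : ∀ b → 0ℚ ℚ.≤ S b
  0≤S b = sum-nonneg (allBits m) (0≤F ∘ (b ∷_))
  ≤total : ∀ b → S b ℚ.≤ S true ℚ.+ S false
  ≤total true = ℚₚ.≤-trans (ℚₚ.≤-reflexive (sym (ℚₚ.+-identityʳ (S true))))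
    (ℚₚ.+-monoʳ-≤ (S true) (0≤S false))
  ≤total false = ℚₚ.≤-trans (ℚₚ.≤-reflexive (sym (ℚₚ.+-identityˡ (S false))))
    (ℚₚ.+-monoˡ-≤ (S false) (0≤S true))

*-interchange : ∀ a b c d → (a ℚ.* b) ℚ.* (c ℚ.* d) ≡ (a ℚ.* c) ℚ.* (b ℚ.* d)
*-interchange = solve 4 (λ a b c d → (a :* b) :* (c :* d) := (a :* c) :* (b :* d)) refl

-- Probabilities in the random graph

indicator : Bool → ℚ
indicator b = if b then 1ℚ else 0ℚ

module Weights (p : ℚ) where

  bitsWeight : ∀ {m} → Vec Bool m → ℚ
  bitsWeight [] = 1ℚ
  bitsWeight (b ∷ v) = (if b then p else (1ℚ ℚ.- p)) ℚ.* bitsWeight v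

  weight : ∀ {n} → Outcome n → ℚ
  weight {zero} _ = 1ℚ
  weight {suc n} (v , ω) = bitsWeight v ℚ.* weight ω

  𝔼 : ∀ {n} → (Outcome n → ℚ) → ℚ
  𝔼 {n} F = sumOver (allOutcomes n) λ ω → weight ω ℚ.* F ω

  avoids : ∀ {m} → Subset m → Vec Bool m → ℚ
  avoids [] [] = 1ℚ
  avoids (a ∷ F) (b ∷ v) = (if a then (if b then 0ℚ else 1ℚ) else 1ℚ) ℚ.* avoids F v

  -- The bits of the first vertex that have to be false in an outcome without an edge between a ∷ A
  -- and b ∷ B. The case of two trues is junk: it does not arise for disjoint sets.
  forbidden : ∀ {m} → Bool → Bool → Subset m → Subset m → Subset m
  forbidden true  _     A B = B
  forbidden false true  A B = A
  forbidden false false A B = ∅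

  -- For disjoint sets this is the indicator that no edge joins them. The product form, vertex by
  -- vertex and bit by bit, lets its expectation factorise.
  noEdge : ∀ {n} → Subset n → Subset n → Outcome n → ℚ
  noEdge [] [] _ = 1ℚ
  noEdge (a ∷ A) (b ∷ B) (v , ω) = avoids (forbidden a b A B) v ℚ.* noEdge A B ω

  forbidden-count : ∀ {m} → Subset m → Subset m → ℕ
  forbidden-count [] [] = 0
  forbidden-count (a ∷ A) (b ∷ B) = card (forbidden a b A B) ℕ.+ forbidden-count A B

  -- A bit that must be false contributes 1 - p, a free bit p + (1 - p) = 1.
  sum-avoids : ∀ {m} (F : Subset m) →
    sumOver (allBits m) (λ v → bitsWeight v ℚ.* avoids F v) ≡ (1ℚ ℚ.- p) ^ card F
  sum-avoids [] = refl
  sum-avoids {suc m} (a ∷ F) = trans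
    (sum-allBits m (λ v → bitsWeight v ℚ.* avoids (a ∷ F) v))
    (trans (cong₂ ℚ._+_ (branch true) (branch false)) (combine a))
    where
    S : ℚ
    S = sumOver (allBits m) (λ v → bitsWeight v ℚ.* avoids F v)
    coeff : Bool → ℚ
    coeff b = (if b then p else (1ℚ ℚ.- p)) ℚ.* (if a then (if b then 0ℚ else 1ℚ) else 1ℚ)
    branch : ∀ b → sumOver (allBits m) (λ v → bitsWeight (b ∷ v) ℚ.* avoids (a ∷ F) (b ∷ v)) ≡
      coeff b ℚ.* S
    branch b = trans
      (sum-cong (allBits m) λ v → *-interchange (if b then p else (1ℚ ℚ.- p)) (bitsWeight v)
        (if a then (if b then 0ℚ else 1ℚ) else 1ℚ) (avoids F v))
      (sum-* (allBits m) (coeff b) (λ v → bitsWeight v ℚ.* avoids F v))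
    combine : ∀ a →
      (p ℚ.* (if a then 0ℚ else 1ℚ)) ℚ.* S ℚ.+ ((1ℚ ℚ.- p) ℚ.* (if a then 1ℚ else 1ℚ)) ℚ.* S
      ≡ (1ℚ ℚ.- p) ^ card (a ∷ F)
    combine true = trans
      (solve 2 (λ p s →
        (p :* con 0ℚ) :* s :+ ((con 1ℚ :- p) :* con 1ℚ) :* s := (con 1ℚ :- p) :* s) refl p S)
      (cong ((1ℚ ℚ.- p) ℚ.*_) (sum-avoids F))
    combine false = trans
      (solve 2 (λ p s → (p :* con 1ℚ) :* s :+ ((con 1ℚ :- p) :* con 1ℚ) :* s := s) refl p S)
      (sum-avoids F)

  -- Independence: weight and indicator both split into a factor for the bits of the first vertex
  -- and a factor for the remaining graph.
  𝔼-noEdge : ∀ {n} (A B : Subset n) → 𝔼 (noEdge A B) ≡ (1ℚ ℚ.- p) ^ forbidden-count A B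
  𝔼-noEdge [] [] = refl
  𝔼-noEdge {suc n} (a ∷ A) (b ∷ B) = begin
    𝔼 (noEdge (a ∷ A) (b ∷ B))
      ≡⟨ sum-× (allBits n) (allOutcomes n) (λ ω → weight ω ℚ.* noEdge (a ∷ A) (b ∷ B) ω) ⟩
    sumOver (allBits n) (λ v → sumOver (allOutcomes n) λ ω →
      (bitsWeight v ℚ.* weight ω) ℚ.* (avoids F v ℚ.* noEdge A B ω))
      ≡⟨ sum-cong (allBits n) (λ v → trans
           (sum-cong (allOutcomes n) λ ω →
             *-interchange (bitsWeight v) (weight ω) (avoids F v) (noEdge A B ω))
           (trans (sum-* (allOutcomes n) (bitsWeight v ℚ.* avoids F v)
                    (λ ω → weight ω ℚ.* noEdge A B ω))
             (ℚₚ.*-comm (bitsWeight v ℚ.* avoids F v) (𝔼 (noEdge A B))))) ⟩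
    sumOver (allBits n) (λ v → 𝔼 (noEdge A B) ℚ.* (bitsWeight v ℚ.* avoids F v))
      ≡⟨ sum-* (allBits n) (𝔼 (noEdge A B)) (λ v → bitsWeight v ℚ.* avoids F v) ⟩
    𝔼 (noEdge A B) ℚ.* sumOver (allBits n) (λ v → bitsWeight v ℚ.* avoids F v)
      ≡⟨ cong₂ ℚ._*_ (𝔼-noEdge A B) (sum-avoids F) ⟩
    (1ℚ ℚ.- p) ^ forbidden-count A B ℚ.* (1ℚ ℚ.- p) ^ card F
      ≡⟨ ℚₚ.*-comm ((1ℚ ℚ.- p) ^ forbidden-count A B) _ ⟩
    (1ℚ ℚ.- p) ^ card F ℚ.* (1ℚ ℚ.- p) ^ forbidden-count A B
      ≡⟨ ^-homo-* (1ℚ ℚ.- p) (card F) (forbidden-count A B) ⟨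
    (1ℚ ℚ.- p) ^ (card F ℕ.+ forbidden-count A B) ∎
    where
    open ≡-Reasoning
    F : Subset n
    F = forbidden a b A B

  if-nonneg : ∀ b {x y} → 0ℚ ℚ.≤ x → 0ℚ ℚ.≤ y → 0ℚ ℚ.≤ (if b then x else y)
  if-nonneg true 0≤x 0≤y = 0≤x
  if-nonneg false 0≤x 0≤y = 0≤y

  avoids-nonneg : ∀ {m} (F : Subset m) v → 0ℚ ℚ.≤ avoids F v
  avoids-nonneg [] [] = 0≤1
  avoids-nonneg (a ∷ F) (b ∷ v) =
    0≤* (if-nonneg a (if-nonneg b ℚₚ.≤-refl 0≤1) 0≤1) (avoids-nonneg F v)

  noEdge-nonneg : ∀ {n} (A B : Subset n) ω → 0ℚ ℚ.≤ noEdge A B ω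
  noEdge-nonneg [] [] ω = 0≤1
  noEdge-nonneg (a ∷ A) (b ∷ B) (v , ω) =
    0≤* (avoids-nonneg (forbidden a b A B) v) (noEdge-nonneg A B ω)

  avoids≡1 : ∀ {m} (F : Subset m) v → (∀ {j} → j ∈ F → ¬ T (lookup v j)) → avoids F v ≡ 1ℚ
  avoids≡1 [] [] _ = refl
  avoids≡1 (false ∷ F) (b ∷ v) clear = trans (ℚₚ.*-identityˡ _) (avoids≡1 F v (clear ∘ there))
  avoids≡1 (true ∷ F) (false ∷ v) clear = trans (ℚₚ.*-identityˡ _) (avoids≡1 F v (clear ∘ there))
  avoids≡1 (true ∷ F) (true ∷ v) clear = ⊥-elim (clear here tt)

  noEdge≡1 : ∀ {n} (A B : Subset n) (ω : Outcome n) →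
    (∀ a b → a ∈ A → b ∈ B → ¬ T (edge ω a b)) → noEdge A B ω ≡ 1ℚ
  noEdge≡1 [] [] ω _ = refl
  noEdge≡1 (a ∷ A) (b ∷ B) (v , ω) clear = cong₂ ℚ._*_
    (avoids≡1 (forbidden a b A B) v (forbidden-clear a b clear))
    (noEdge≡1 A B ω λ i j i∈ j∈ → clear (suc i) (suc j) (there i∈) (there j∈))
    where
    forbidden-clear : ∀ a b → (∀ i j → i ∈ a ∷ A → j ∈ b ∷ B → ¬ T (edge (v , ω) i j)) →
      ∀ {j} → j ∈ forbidden a b A B → ¬ T (lookup v j)
    forbidden-clear true b clear j∈ = clear zero (suc _) here (there j∈)
    forbidden-clear false true clear j∈ = clear (suc _) zero (there j∈) here
    forbidden-clear false false clear j∈ = ⊥-elim (∉⊥ j∈)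

  -- Each pair from `A` and `B` is counted once, at whichever of its two vertices comes first.
  forbidden-count-disjoint : ∀ {n} (A B : Subset n) → (∀ x → x ∈ A → x ∉ B) →
    forbidden-count A B ≡ card A ℕ.* card B
  forbidden-count-disjoint [] [] _ = refl
  forbidden-count-disjoint {suc n} (a ∷ A) (b ∷ B) disjoint = trans
    (cong (card (forbidden a b A B) ℕ.+_)
      (forbidden-count-disjoint A B λ x x∈A x∈B → disjoint (suc x) (there x∈A) (there x∈B)))
    (go a b disjoint)
    where
    go : ∀ a b → (∀ x → x ∈ a ∷ A → x ∉ b ∷ B) →
      card (forbidden a b A B) ℕ.+ card A ℕ.* card B ≡ card (a ∷ A) ℕ.* card (b ∷ B)
    go true true disjoint = ⊥-elim (disjoint zero here here)
    go true false disjoint = refl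
    go false true disjoint = sym (ℕₚ.*-suc (card A) (card B))
    go false false disjoint = cong (ℕ._+ card A ℕ.* card B) (∣⊥∣≡0 n)

  -- This is `𝔼-noEdge` for two empty sets, which forbid nothing.
  𝔼-1 : ∀ n → 𝔼 {n} (const 1ℚ) ≡ 1ℚ
  𝔼-1 n = begin
    𝔼 {n} (const 1ℚ)
      ≡⟨ sum-cong (allOutcomes n) (λ ω → cong (weight ω ℚ.*_)
           (noEdge≡1 ∅ ∅ ω λ _ _ a∈ _ → ⊥-elim (∉⊥ a∈))) ⟨
    𝔼 {n} (noEdge ∅ ∅)
      ≡⟨ 𝔼-noEdge {n} ∅ ∅ ⟩
    (1ℚ ℚ.- p) ^ forbidden-count {n} ∅ ∅
      ≡⟨ cong ((1ℚ ℚ.- p) ^_) (trans (forbidden-count-disjoint {n} ∅ ∅ λ _ x∈ → ⊥-elim (∉⊥ x∈))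
           (cong (ℕ._* card (∅ {n})) (∣⊥∣≡0 n))) ⟩
    1ℚ ∎
    where open ≡-Reasoning

  module _ (0≤p : 0ℚ ℚ.≤ p) (p≤1 : p ℚ.≤ 1ℚ) where

    0≤1-p : 0ℚ ℚ.≤ 1ℚ ℚ.- p
    0≤1-p = subst (ℚ._≤ 1ℚ ℚ.- p) (ℚₚ.+-inverseʳ p) (ℚₚ.+-monoˡ-≤ (ℚ.- p) p≤1)

    1-p≤1 : 1ℚ ℚ.- p ℚ.≤ 1ℚ
    1-p≤1 = ℚₚ.≤-trans (ℚₚ.+-monoʳ-≤ 1ℚ (ℚₚ.neg-antimono-≤ 0≤p)) ℚₚ.≤-refl

    bitsWeight-nonneg : ∀ {m} (v : Vec Bool m) → 0ℚ ℚ.≤ bitsWeight v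
    bitsWeight-nonneg [] = 0≤1
    bitsWeight-nonneg (b ∷ v) = 0≤* (if-nonneg b 0≤p 0≤1-p) (bitsWeight-nonneg v)

    weight-nonneg : ∀ {n} (ω : Outcome n) → 0ℚ ℚ.≤ weight ω
    weight-nonneg {zero} _ = 0≤1
    weight-nonneg {suc n} (v , ω) = 0≤* (bitsWeight-nonneg v) (weight-nonneg ω)

    𝔼-mono : ∀ {n} {F G : Outcome n → ℚ} → (∀ ω → F ω ℚ.≤ G ω) → 𝔼 F ℚ.≤ 𝔼 G
    𝔼-mono {n} F≤G = sum-mono (allOutcomes n) λ ω → *-monoʳ-≤ (weight-nonneg ω) (F≤G ω)

    𝔼-noEdge-≤ : ∀ {n} s (A B : Subset n) → LargePair s A B →
      𝔼 (noEdge A B) ℚ.≤ (1ℚ ℚ.- p) ^ (s ℕ.* s)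
    𝔼-noEdge-≤ s A B (disjoint , s≤A , s≤B) = begin
      𝔼 (noEdge A B)
        ≡⟨ 𝔼-noEdge A B ⟩
      (1ℚ ℚ.- p) ^ forbidden-count A B
        ≡⟨ cong ((1ℚ ℚ.- p) ^_) (forbidden-count-disjoint A B disjoint) ⟩
      (1ℚ ℚ.- p) ^ (card A ℕ.* card B)
        ≤⟨ ^-antimono 0≤1-p 1-p≤1 (ℕₚ.*-mono-≤ s≤A s≤B) ⟩
      (1ℚ ℚ.- p) ^ (s ℕ.* s) ∎
      where open ℚₚ.≤-Reasoning

    module _ (n s : ℕ) where

      adj? : ∀ (ω : Outcome n) → Decidable₂ (Adj (graph ω))
      adj? ω i j = T? (edge ω i j)

      joinedEvent : Event n
      joinedEvent ω = [ const true , const false ]′ (joined⊎separated (adj? ω) s)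

      joinedEvent⇒joined : ∀ ω → T (joinedEvent ω) → Joined (Adj (graph ω)) s
      joinedEvent⇒joined ω E with joined⊎separated (adj? ω) s
      ... | inj₁ joined = joined

      pairWeight : Subset n → Subset n → Outcome n → ℚ
      pairWeight A B ω = if does (largePair? s A B) then noEdge A B ω else 0ℚ

      pairWeight-nonneg : ∀ A B ω → 0ℚ ℚ.≤ pairWeight A B ω
      pairWeight-nonneg A B ω = if-nonneg (does (largePair? s A B)) (noEdge-nonneg A B ω) ℚₚ.≤-refl

      pairWeight≡1 : ∀ A B ω → Separated (Adj (graph ω)) s A B → pairWeight A B ω ≡ 1ℚ
      pairWeight≡1 A B ω (large , clear) = trans
        (cong (if_then noEdge A B ω else 0ℚ) (dec-true (largePair? s A B) large))
        (noEdge≡1 A B ω clear)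

      𝔼-pairWeight : ∀ A B → 𝔼 (pairWeight A B) ℚ.≤ (1ℚ ℚ.- p) ^ (s ℕ.* s)
      𝔼-pairWeight A B = go (largePair? s A B)
        where
        go : ∀ (large? : Dec (LargePair s A B)) →
          𝔼 (λ ω → if does large? then noEdge A B ω else 0ℚ) ℚ.≤ (1ℚ ℚ.- p) ^ (s ℕ.* s)
        go (yes large) = 𝔼-noEdge-≤ s A B large
        go (no _) = ℚₚ.≤-trans (ℚₚ.≤-reflexive (trans
          (sum-cong (allOutcomes n) λ ω → ℚₚ.*-zeroʳ (weight ω)) (sum-0 (allOutcomes n))))
          (^-nonneg 0≤1-p (s ℕ.* s))

      -- The number of ordered separated pairs. As `Subset n` is `Vec Bool n`, the list `allBits n`
      -- enumerates the subsets.
      badWeight : Outcome n → ℚ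
      badWeight ω = sumOver (allBits n) λ A → sumOver (allBits n) λ B → pairWeight A B ω

      badWeight-nonneg : ∀ ω → 0ℚ ℚ.≤ badWeight ω
      badWeight-nonneg ω = sum-nonneg (allBits n) λ A →
        sum-nonneg (allBits n) λ B → pairWeight-nonneg A B ω

      -- The union bound at a single outcome: when the event fails, the separated pair that was
      -- found contributes 1 to `badWeight`.
      1≤good+bad : ∀ ω → 1ℚ ℚ.≤ indicator (joinedEvent ω) ℚ.+ badWeight ω
      1≤good+bad ω with joined⊎separated (adj? ω) s
      ... | inj₁ _ = subst (ℚ._≤ 1ℚ ℚ.+ badWeight ω) (ℚₚ.+-identityʳ 1ℚ)
              (ℚₚ.+-monoʳ-≤ 1ℚ (badWeight-nonneg ω))
      ... | inj₂ (A , B , sep) = begin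
              1ℚ
                ≡⟨ pairWeight≡1 A B ω sep ⟨
              pairWeight A B ω
                ≤⟨ ≤sum-allBits (λ B → pairWeight A B ω) (λ B → pairWeight-nonneg A B ω) B ⟩
              sumOver (allBits n) (λ B → pairWeight A B ω)
                ≤⟨ ≤sum-allBits (λ A → sumOver (allBits n) λ B → pairWeight A B ω)
                     (λ A → sum-nonneg (allBits n) λ B → pairWeight-nonneg A B ω) A ⟩
              badWeight ω
                ≡⟨ ℚₚ.+-identityˡ (badWeight ω) ⟨
              0ℚ ℚ.+ badWeight ω ∎
              where open ℚₚ.≤-Reasoning

      -- Linearity of expectation; the two powers of 2 count the choices of `A` and of `B`.
      𝔼-badWeight : 𝔼 badWeight ℚ.≤ 2ℚ ^ n ℚ.* (2ℚ ^ n ℚ.* (1ℚ ℚ.- p) ^ (s ℕ.* s))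
      𝔼-badWeight = begin
        𝔼 badWeight
          ≡⟨ 𝔼-sum (λ A ω → sumOver (allBits n) λ B → pairWeight A B ω) ⟩
        sumOver (allBits n) (λ A → 𝔼 (λ ω → sumOver (allBits n) λ B → pairWeight A B ω))
          ≡⟨ sum-cong (allBits n) (λ A → 𝔼-sum (pairWeight A)) ⟩
        sumOver (allBits n) (λ A → sumOver (allBits n) λ B → 𝔼 (pairWeight A B))
          ≤⟨ sum-mono (allBits n) (λ A → sum-mono (allBits n) (𝔼-pairWeight A)) ⟩
        sumOver (allBits n) (λ A → sumOver (allBits n) λ B → K)
          ≡⟨ sum-cong (allBits n) (λ A → sum-allBits-const n K) ⟩
        sumOver (allBits n) (λ A → 2ℚ ^ n ℚ.* K)
          ≡⟨ sum-allBits-const n (2ℚ ^ n ℚ.* K) ⟩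
        2ℚ ^ n ℚ.* (2ℚ ^ n ℚ.* K) ∎
        where
        open ℚₚ.≤-Reasoning
        K : ℚ
        K = (1ℚ ℚ.- p) ^ (s ℕ.* s)
        𝔼-sum : ∀ (F : Subset n → Outcome n → ℚ) →
          𝔼 (λ ω → sumOver (allBits n) λ A → F A ω) ≡ sumOver (allBits n) (λ A → 𝔼 (F A))
        𝔼-sum F = trans
          (sum-cong (allOutcomes n) λ ω → sym (sum-* (allBits n) (weight ω) (λ A → F A ω)))
          (sum-swap (allOutcomes n) (allBits n) (λ ω A → weight ω ℚ.* F A ω))

      union-bound : 1ℚ ℚ.≤ 𝔼 (indicator ∘ joinedEvent) ℚ.+
        2ℚ ^ n ℚ.* (2ℚ ^ n ℚ.* (1ℚ ℚ.- p) ^ (s ℕ.* s))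
      union-bound = begin
        1ℚ
          ≡⟨ 𝔼-1 n ⟨
        𝔼 {n} (const 1ℚ)
          ≤⟨ 𝔼-mono 1≤good+bad ⟩
        𝔼 (λ ω → indicator (joinedEvent ω) ℚ.+ badWeight ω)
          ≡⟨ sum-cong (allOutcomes n) (λ ω →
               ℚₚ.*-distribˡ-+ (weight ω) (indicator (joinedEvent ω)) (badWeight ω)) ⟩
        sumOver (allOutcomes n)
          (λ ω → weight ω ℚ.* indicator (joinedEvent ω) ℚ.+ weight ω ℚ.* badWeight ω)
          ≡⟨ sum-+ (allOutcomes n)
               (λ ω → weight ω ℚ.* indicator (joinedEvent ω)) (λ ω → weight ω ℚ.* badWeight ω) ⟩
        𝔼 (indicator ∘ joinedEvent) ℚ.+ 𝔼 badWeight
          ≤⟨ ℚₚ.+-monoʳ-≤ (𝔼 (indicator ∘ joinedEvent)) 𝔼-badWeight ⟩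
        𝔼 (indicator ∘ joinedEvent) ℚ.+ 2ℚ ^ n ℚ.* (2ℚ ^ n ℚ.* (1ℚ ℚ.- p) ^ (s ℕ.* s)) ∎
        where open ℚₚ.≤-Reasoning

-- Real probabilities as sequences of rational expectations

seq-bitsMass : ∀ P k {m} (v : Vec Bool m) → seq (bitsMass P v) k ≡ Weights.bitsWeight (seq P k) v
seq-bitsMass P k [] = refl
seq-bitsMass P k (true ∷ v) = cong (seq P k ℚ.*_) (seq-bitsMass P k v)
seq-bitsMass P k (false ∷ v) = cong ((1ℚ ℚ.- seq P k) ℚ.*_) (seq-bitsMass P k v)

seq-mass : ∀ P k {n} (ω : Outcome n) → seq (mass P ω) k ≡ Weights.weight (seq P k) ω
seq-mass P k {zero} _ = refl
seq-mass P k {suc n} (v , ω) = cong₂ ℚ._*_ (seq-bitsMass P k v) (seq-mass P k ω)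

seq-sum : ∀ {A : Set} (h : A → ℝ) k xs →
  seq (foldr _+_ 0ℝ (map h xs)) k ≡ sumOver xs (λ x → seq (h x) k)
seq-sum h k [] = refl
seq-sum h k (x ∷ xs) = cong (seq (h x) k ℚ.+_) (seq-sum h k xs)

sum-filter : ∀ {A : Set} (E : A → Bool) (F : A → ℚ) xs →
  sumOver (filterᵇ E xs) F ≡ sumOver xs (λ x → F x ℚ.* indicator (E x))
sum-filter E F [] = refl
sum-filter E F (x ∷ xs) with E x
... | true = cong₂ ℚ._+_ (sym (ℚₚ.*-identityʳ (F x))) (sum-filter E F xs)
... | false = trans (sum-filter E F xs)
  (sym (trans (cong (ℚ._+ rest) (ℚₚ.*-zeroʳ (F x))) (ℚₚ.+-identityˡ rest)))
  where
  rest : ℚ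
  rest = sumOver xs (λ x → F x ℚ.* indicator (E x))

seq-ℙ : ∀ P k {n} (E : Event n) → seq (ℙ P E) k ≡ Weights.𝔼 (seq P k) (indicator ∘ E)
seq-ℙ P k {n} E = trans (seq-sum (mass P) k (filterᵇ E (allOutcomes n)))
  (trans (sum-filter E (λ ω → seq (mass P ω) k) (allOutcomes n))
    (sum-cong (allOutcomes n) λ ω → cong (ℚ._* indicator (E ω)) (seq-mass P k ω)))

-- Natural numbers as rationals

ι : ℕ → ℚ
ι n = ℤ.+ n ℚ./ 1

toℚᵘ-ι : ∀ n → ℚ.toℚᵘ (ι n) ℚᵘ.≃ mkℚᵘ (ℤ.+ n) 0
toℚᵘ-ι n = ℚₚ.toℚᵘ-fromℚᵘ (mkℚᵘ (ℤ.+ n) 0)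

ι-+ : ∀ m n → ι (m ℕ.+ n) ≡ ι m ℚ.+ ι n
ι-+ m n = ℚₚ.toℚᵘ-injective (begin
  ℚ.toℚᵘ (ι (m ℕ.+ n))                ≈⟨ toℚᵘ-ι (m ℕ.+ n) ⟩
  mkℚᵘ (ℤ.+ (m ℕ.+ n)) 0              ≈⟨ *≡* (cong (ℤ._* ℤ.+ 1) (sym
                                           (cong₂ ℤ._+_ (ℤₚ.*-identityʳ (ℤ.+ m)) (ℤₚ.*-identityʳ (ℤ.+ n))))) ⟩
  mkℚᵘ (ℤ.+ m) 0 ℚᵘ.+ mkℚᵘ (ℤ.+ n) 0  ≈⟨ ℚᵘₚ.+-cong (toℚᵘ-ι m) (toℚᵘ-ι n) ⟨
  ℚ.toℚᵘ (ι m) ℚᵘ.+ ℚ.toℚᵘ (ι n)      ≈⟨ ℚₚ.toℚᵘ-homo-+ (ι m) (ι n) ⟨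
  ℚ.toℚᵘ (ι m ℚ.+ ι n)                ∎)
  where open ℚᵘₚ.≃-Reasoning

ι-* : ∀ m n → ι (m ℕ.* n) ≡ ι m ℚ.* ι n
ι-* zero n = sym (ℚₚ.*-zeroˡ (ι n))
ι-* (suc m) n = trans (ι-+ n (m ℕ.* n)) (trans (cong (ι n ℚ.+_) (ι-* m n))
  (trans (solve 2 (λ a b → b :+ a :* b := (con 1ℚ :+ a) :* b) refl (ι m) (ι n))
    (cong (ℚ._* ι n) (sym (ι-+ 1 m)))))

ι-nonneg : ∀ n → 0ℚ ℚ.≤ ι n
ι-nonneg n = ℚₚ.nonNegative⁻¹ (ι n) {{ℚₚ.normalize-nonNeg n 1}}

ι-mono : ∀ {m n} → m ℕ.≤ n → ι m ℚ.≤ ι n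
ι-mono {m} {n} m≤n = begin
  ι m                       ≡⟨ ℚₚ.+-identityʳ (ι m) ⟨
  ι m ℚ.+ 0ℚ                ≤⟨ ℚₚ.+-monoʳ-≤ (ι m) (ι-nonneg (n ℕ.∸ m)) ⟩
  ι m ℚ.+ ι (n ℕ.∸ m)       ≡⟨ ι-+ m (n ℕ.∸ m) ⟨
  ι (m ℕ.+ (n ℕ.∸ m))       ≡⟨ cong ι (ℕₚ.m+[n∸m]≡n m≤n) ⟩
  ι n                       ∎
  where open ℚₚ.≤-Reasoning

ι-inverse : ∀ n .{{_ : NonZero n}} → ι n ℚ.* (ℤ.+ 1 ℚ./ n) ≡ 1ℚ
ι-inverse (suc n) = ℚₚ.toℚᵘ-injective (begin
  ℚ.toℚᵘ (ι (suc n) ℚ.* (ℤ.+ 1 ℚ./ suc n))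
    ≈⟨ ℚₚ.toℚᵘ-homo-* (ι (suc n)) (ℤ.+ 1 ℚ./ suc n) ⟩
  ℚ.toℚᵘ (ι (suc n)) ℚᵘ.* ℚ.toℚᵘ (ℤ.+ 1 ℚ./ suc n)
    ≈⟨ ℚᵘₚ.*-cong (toℚᵘ-ι (suc n)) (ℚₚ.toℚᵘ-fromℚᵘ (mkℚᵘ (ℤ.+ 1) n)) ⟩
  mkℚᵘ (ℤ.+ suc n) 0 ℚᵘ.* mkℚᵘ (ℤ.+ 1) n
    ≈⟨ *≡* (cong ℤ.+_ (cross n)) ⟩
  ℚ.toℚᵘ 1ℚ ∎)
  where
  open ℚᵘₚ.≃-Reasoning
  cross : ∀ n → suc n ℕ.* 1 ℕ.* 1 ≡ 1 ℕ.* (1 ℕ.* suc n)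
  cross = solve-∀

-- The witness is the denominator of `e`: the product is then the numerator, a positive integer.
archimedean : ∀ {e} → 0ℚ ℚ.< e → ∃[ d ] 1ℚ ℚ.≤ ι d ℚ.* e
archimedean {e} 0<e = go e (ℚ.positive 0<e)
  where
  go : ∀ e → ℚ.Positive e → ∃[ d ] 1ℚ ℚ.≤ ι d ℚ.* e
  go e@(ℚ.mkℚ (ℤ.+ suc a) d _) _ = suc d ,
    subst (1ℚ ℚ.≤_) (sym clear) (ι-mono {1} {suc a} (s≤s z≤n))
    where
    open ℚᵘₚ.≃-Reasoning
    cross : ∀ a d → suc d ℕ.* suc a ℕ.* 1 ≡ suc a ℕ.* (1 ℕ.* suc d)
    cross = solve-∀
    clear : ι (suc d) ℚ.* e ≡ ι (suc a)
    clear = ℚₚ.toℚᵘ-injective (begin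
      ℚ.toℚᵘ (ι (suc d) ℚ.* e)                        ≈⟨ ℚₚ.toℚᵘ-homo-* (ι (suc d)) e ⟩
      ℚ.toℚᵘ (ι (suc d)) ℚᵘ.* ℚ.toℚᵘ e                ≈⟨ ℚᵘₚ.*-congʳ (toℚᵘ-ι (suc d)) ⟩
      mkℚᵘ (ℤ.+ suc d) 0 ℚᵘ.* mkℚᵘ (ℤ.+ suc a) d      ≈⟨ *≡* (cong ℤ.+_ (cross a d)) ⟩
      mkℚᵘ (ℤ.+ suc a) 0                              ≈⟨ toℚᵘ-ι (suc a) ⟨
      ℚ.toℚᵘ (ι (suc a))                              ∎)

archimedean-≥ : ∀ m {e} → 0ℚ ℚ.< e → ∃[ d ] m ℕ.≤ d × 1ℚ ℚ.≤ ι d ℚ.* e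
archimedean-≥ m {e} 0<e with archimedean 0<e
... | d , 1≤de = m ℕ.+ d , ℕₚ.m≤m+n m d , ℚₚ.≤-trans 1≤de
  (*-monoˡ-≤ (ℚₚ.<⇒≤ 0<e) (ι-mono {d} {m ℕ.+ d} (ℕₚ.m≤n+m d m)))

-- Numerical bounds

-- Induction on `k`: (1 - p)(1 + (k + 1)p) = 1 + kp - (k + 1)p², which is at most 1 + kp.
bernoulli : ∀ {p} → 0ℚ ℚ.≤ p → p ℚ.≤ 1ℚ → ∀ k → (1ℚ ℚ.- p) ^ k ℚ.* (1ℚ ℚ.+ ι k ℚ.* p) ℚ.≤ 1ℚ
bernoulli {p} 0≤p p≤1 zero =
  ℚₚ.≤-reflexive (solve 1 (λ p → con 1ℚ :* (con 1ℚ :+ con 0ℚ :* p) := con 1ℚ) refl p)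
bernoulli {p} 0≤p p≤1 (suc k) = begin
  q ℚ.* q ^ k ℚ.* (1ℚ ℚ.+ ι (suc k) ℚ.* p)
    ≡⟨ cong (λ t → q ℚ.* q ^ k ℚ.* (1ℚ ℚ.+ t ℚ.* p)) (ι-+ 1 k) ⟩
  q ℚ.* q ^ k ℚ.* (1ℚ ℚ.+ (1ℚ ℚ.+ ι k) ℚ.* p)
    ≡⟨ solve 3 (λ p x i → (con 1ℚ :- p) :* x :* (con 1ℚ :+ (con 1ℚ :+ i) :* p) :=
         x :* (con 1ℚ :+ i :* p) :- x :* ((con 1ℚ :+ i) :* (p :* p))) refl p (q ^ k) (ι k) ⟩
  q ^ k ℚ.* (1ℚ ℚ.+ ι k ℚ.* p) ℚ.- q ^ k ℚ.* ((1ℚ ℚ.+ ι k) ℚ.* (p ℚ.* p))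
    ≤⟨ ℚₚ.+-monoʳ-≤ (q ^ k ℚ.* (1ℚ ℚ.+ ι k ℚ.* p)) (ℚₚ.neg-antimono-≤ 0≤loss) ⟩
  q ^ k ℚ.* (1ℚ ℚ.+ ι k ℚ.* p) ℚ.+ 0ℚ
    ≡⟨ ℚₚ.+-identityʳ _ ⟩
  q ^ k ℚ.* (1ℚ ℚ.+ ι k ℚ.* p)
    ≤⟨ bernoulli 0≤p p≤1 k ⟩
  1ℚ ∎
  where
  open ℚₚ.≤-Reasoning
  q : ℚ
  q = 1ℚ ℚ.- p
  0≤loss : 0ℚ ℚ.≤ q ^ k ℚ.* ((1ℚ ℚ.+ ι k) ℚ.* (p ℚ.* p))
  0≤loss = 0≤* (^-nonneg (0≤1-q 0≤p p≤1) k)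
    (0≤* (ℚₚ.+-mono-≤ 0≤1 (ι-nonneg k)) (0≤* 0≤p 0≤p))
    where 0≤1-q = Weights.0≤1-p p

-- Every block of `k` non-edges costs a factor of at least 2, because 1 + kp is at least 2 in
-- `bernoulli`.
decay : ∀ {p} → 0ℚ ℚ.≤ p → p ℚ.≤ 1ℚ → ∀ k → 1ℚ ℚ.≤ ι k ℚ.* p → 2ℚ ℚ.* (1ℚ ℚ.- p) ^ k ℚ.≤ 1ℚ
decay {p} 0≤p p≤1 k 1≤kp = begin
  2ℚ ℚ.* (1ℚ ℚ.- p) ^ k
    ≡⟨ ℚₚ.*-comm 2ℚ ((1ℚ ℚ.- p) ^ k) ⟩
  (1ℚ ℚ.- p) ^ k ℚ.* 2ℚ
    ≤⟨ *-monoʳ-≤ (^-nonneg (Weights.0≤1-p p 0≤p p≤1) k) (ℚₚ.+-monoʳ-≤ 1ℚ 1≤kp) ⟩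
  (1ℚ ℚ.- p) ^ k ℚ.* (1ℚ ℚ.+ ι k ℚ.* p)
    ≤⟨ bernoulli 0≤p p≤1 k ⟩
  1ℚ ∎
  where open ℚₚ.≤-Reasoning

n≤2^n : ∀ n → ι n ℚ.≤ 2ℚ ^ n
n≤2^n zero = 0≤1
n≤2^n (suc n) = begin
  ι (suc n)               ≡⟨ ι-+ 1 n ⟩
  1ℚ ℚ.+ ι n              ≤⟨ ℚₚ.+-mono-≤ (1≤2^ n) (n≤2^n n) ⟩
  2ℚ ^ n ℚ.+ 2ℚ ^ n       ≡⟨ solve 1 (λ t → t :+ t := (con 1ℚ :+ con 1ℚ) :* t) refl (2ℚ ^ n) ⟩
  2ℚ ^ suc n              ∎
  where
  open ℚₚ.≤-Reasoning
  1≤2^ : ∀ n → 1ℚ ℚ.≤ 2ℚ ^ n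
  1≤2^ zero = ℚₚ.≤-refl
  1≤2^ (suc n) = begin
    1ℚ                      ≤⟨ 1≤2^ n ⟩
    2ℚ ^ n                  ≡⟨ ℚₚ.*-identityˡ (2ℚ ^ n) ⟨
    1ℚ ℚ.* 2ℚ ^ n           ≤⟨ *-monoˡ-≤ (^-nonneg (ℚₚ.nonNegative⁻¹ 2ℚ) n) (ℚₚ.+-monoʳ-≤ 1ℚ 0≤1) ⟩
    2ℚ ℚ.* 2ℚ ^ n           ∎

-- The s² potential edges contain 3n blocks of length `k`. By `decay`, two thirds of these blocks
-- pay for the 4ⁿ pairs of sets and the last third for the extra factor 2ⁿ, so the failure
-- probability is at most 2⁻ⁿ.
failure-bound : ∀ {p} → 0ℚ ℚ.≤ p → p ℚ.≤ 1ℚ → ∀ k n s → 1ℚ ℚ.≤ ι k ℚ.* p →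
  k ℕ.* (n ℕ.+ (n ℕ.+ n)) ℕ.≤ s ℕ.* s →
  2ℚ ^ n ℚ.* (2ℚ ^ n ℚ.* (1ℚ ℚ.- p) ^ (s ℕ.* s)) ℚ.* 2ℚ ^ n ℚ.≤ 1ℚ
failure-bound {p} 0≤p p≤1 k n s 1≤kp k3n≤s² = begin
  t ℚ.* (t ℚ.* q ^ (s ℕ.* s)) ℚ.* t
    ≡⟨ solve 2 (λ t x → t :* (t :* x) :* t := (t :* (t :* t)) :* x) refl t (q ^ (s ℕ.* s)) ⟩
  t ℚ.* (t ℚ.* t) ℚ.* q ^ (s ℕ.* s)
    ≤⟨ *-monoʳ-≤ (0≤* 0≤t (0≤* 0≤t 0≤t)) (^-antimono 0≤q (Weights.1-p≤1 p 0≤p p≤1) k3n≤s²) ⟩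
  t ℚ.* (t ℚ.* t) ℚ.* q ^ (k ℕ.* (n ℕ.+ (n ℕ.+ n)))
    ≡⟨ cong₂ ℚ._*_ (trans (cong (t ℚ.*_) (sym (^-homo-* 2ℚ n n))) (sym (^-homo-* 2ℚ n (n ℕ.+ n))))
         (sym (^-assocʳ q k (n ℕ.+ (n ℕ.+ n)))) ⟩
  2ℚ ^ (n ℕ.+ (n ℕ.+ n)) ℚ.* (q ^ k) ^ (n ℕ.+ (n ℕ.+ n))
    ≡⟨ ^-distrib-* 2ℚ (q ^ k) (n ℕ.+ (n ℕ.+ n)) ⟨
  (2ℚ ℚ.* q ^ k) ^ (n ℕ.+ (n ℕ.+ n))
    ≤⟨ ^-≤1 (0≤* (ℚₚ.nonNegative⁻¹ 2ℚ) (^-nonneg 0≤q k)) (decay 0≤p p≤1 k 1≤kp) (n ℕ.+ (n ℕ.+ n)) ⟩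
  1ℚ ∎
  where
  open ℚₚ.≤-Reasoning
  q t : ℚ
  q = 1ℚ ℚ.- p
  t = 2ℚ ^ n
  0≤t : 0ℚ ℚ.≤ t
  0≤t = ^-nonneg (ℚₚ.nonNegative⁻¹ 2ℚ) n
  0≤q : 0ℚ ℚ.≤ q
  0≤q = Weights.0≤1-p p 0≤p p≤1

-- The quotient is at least 1, so the remainder, being below `m`, is no larger than the multiple of
-- `m`.
n≤2[n/m]m : ∀ n m .{{_ : NonZero m}} → m ℕ.≤ n → n ℕ.≤ 2 ℕ.* (n ℕ./ m ℕ.* m)
n≤2[n/m]m n m m≤n = begin
  n                               ≡⟨ m≡m%n+[m/n]*n n m ⟩
  n ℕ.% m ℕ.+ n ℕ./ m ℕ.* m       ≤⟨ ℕₚ.+-monoˡ-≤ (n ℕ./ m ℕ.* m) (ℕₚ.<⇒≤ (m%n<n n m)) ⟩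
  m ℕ.+ n ℕ./ m ℕ.* m             ≤⟨ ℕₚ.+-monoˡ-≤ (n ℕ./ m ℕ.* m) m≤ ⟩
  n ℕ./ m ℕ.* m ℕ.+ n ℕ./ m ℕ.* m ≡⟨ cong (n ℕ./ m ℕ.* m ℕ.+_) (ℕₚ.+-identityʳ _) ⟨
  2 ℕ.* (n ℕ./ m ℕ.* m)           ∎
  where
  open ℕₚ.≤-Reasoning
  m≤ : m ℕ.≤ n ℕ./ m ℕ.* m
  m≤ = ℕₚ.≤-trans (ℕₚ.≤-reflexive (sym (ℕₚ.*-identityˡ m))) (ℕₚ.*-monoˡ-≤ m (m≥n⇒m/n>0 m≤n))

-- `s` is the set size of the expansion property and `k` the block length of `decay`. `sd≤n` makes
-- the exceptional set small, `n≤kC` gives kp at least 1 for p = C/n, and `k3n≤s²` feeds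
-- `failure-bound`.
record Scales (d C n : ℕ) : Set where
  field
    s k       : ℕ
    0<s       : 0 ℕ.< s
    11s≤n     : 11 ℕ.* s ℕ.≤ n
    sd≤n      : s ℕ.* d ℕ.≤ n
    n≤kC      : n ℕ.≤ k ℕ.* C
    k3n≤s²    : k ℕ.* (n ℕ.+ (n ℕ.+ n)) ℕ.≤ s ℕ.* s

scales : ∀ d → 11 ℕ.≤ d → ∃[ C ] (∀ n → C ℕ.≤ n → Scales d C n)
scales d@(suc _) 11≤d = 2 ℕ.* m , at
  where
  m : ℕ
  -- 12 = 3 · 4: the 3 comes from `k3n≤s²`, the 4 from rounding n/d down, which costs a factor 2 in
  -- `s` and so 4 in s². Rounding n/m down costs the factor 2 in C = 2m.
  m = 12 ℕ.* (d ℕ.* d)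
  at : ∀ n → 2 ℕ.* m ℕ.≤ n → Scales d (2 ℕ.* m) n
  at n C≤n = record
    { s = s ; k = k
    ; 0<s = m≥n⇒m/n>0 d≤n
    ; 11s≤n = ℕₚ.≤-trans (ℕₚ.≤-reflexive (ℕₚ.*-comm 11 s))
        (ℕₚ.≤-trans (ℕₚ.*-monoʳ-≤ s 11≤d) (m/n*n≤m n d))
    ; sd≤n = m/n*n≤m n d
    ; n≤kC = ℕₚ.≤-trans (n≤2[n/m]m n m m≤n) (ℕₚ.≤-reflexive (reorder k m))
    ; k3n≤s² = ℕₚ.*-cancelʳ-≤ _ _ (4 ℕ.* (d ℕ.* d)) (begin
        k ℕ.* (n ℕ.+ (n ℕ.+ n)) ℕ.* (4 ℕ.* (d ℕ.* d))
          ≡⟨ regroup k n d ⟩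
        k ℕ.* m ℕ.* n
          ≤⟨ ℕₚ.*-mono-≤ (m/n*n≤m n m) (n≤2[n/m]m n d d≤n) ⟩
        n ℕ.* (2 ℕ.* (s ℕ.* d))
          ≤⟨ ℕₚ.*-monoˡ-≤ (2 ℕ.* (s ℕ.* d)) (n≤2[n/m]m n d d≤n) ⟩
        2 ℕ.* (s ℕ.* d) ℕ.* (2 ℕ.* (s ℕ.* d))
          ≡⟨ square s d ⟩
        s ℕ.* s ℕ.* (4 ℕ.* (d ℕ.* d)) ∎)
    }
    where
    open ℕₚ.≤-Reasoning
    s k : ℕ
    s = n ℕ./ d
    k = n ℕ./ m
    m≤n : m ℕ.≤ n
    m≤n = ℕₚ.≤-trans (ℕₚ.m≤m+n m _) C≤n
    d≤n : d ℕ.≤ n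
    d≤n = ℕₚ.≤-trans (ℕₚ.m≤m*n d d) (ℕₚ.≤-trans (ℕₚ.m≤m+n (d ℕ.* d) _) m≤n)
    reorder : ∀ k m → 2 ℕ.* (k ℕ.* m) ≡ k ℕ.* (2 ℕ.* m)
    reorder = solve-∀
    regroup : ∀ k n d →
      k ℕ.* (n ℕ.+ (n ℕ.+ n)) ℕ.* (4 ℕ.* (d ℕ.* d)) ≡ k ℕ.* (12 ℕ.* (d ℕ.* d)) ℕ.* n
    regroup = solve-∀
    square : ∀ s d → 2 ℕ.* (s ℕ.* d) ℕ.* (2 ℕ.* (s ℕ.* d)) ≡ s ℕ.* s ℕ.* (4 ℕ.* (d ℕ.* d))
    square = solve-∀

-- The failure bound times 2ⁿ is at most 1, while 1 ≤ Mη ≤ nη ≤ 2ⁿη.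
failure-small : ∀ {p η} → 0ℚ ℚ.≤ p → p ℚ.≤ 1ℚ → 0ℚ ℚ.≤ η → ∀ k n s M → 1ℚ ℚ.≤ ι k ℚ.* p →
  k ℕ.* (n ℕ.+ (n ℕ.+ n)) ℕ.≤ s ℕ.* s → 1ℚ ℚ.≤ ι M ℚ.* η → M ℕ.≤ n →
  2ℚ ^ n ℚ.* (2ℚ ^ n ℚ.* (1ℚ ℚ.- p) ^ (s ℕ.* s)) ℚ.≤ η
failure-small {p} {η} 0≤p p≤1 0≤η k n s M 1≤kp k3n≤s² 1≤Mη M≤n = begin
  X                       ≡⟨ ℚₚ.*-identityʳ X ⟨
  X ℚ.* 1ℚ                ≤⟨ *-monoʳ-≤ 0≤X 1≤Mη ⟩
  X ℚ.* (ι M ℚ.* η)       ≤⟨ *-monoʳ-≤ 0≤X (*-monoˡ-≤ 0≤η (ℚₚ.≤-trans (ι-mono M≤n) (n≤2^n n))) ⟩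
  X ℚ.* (2ℚ ^ n ℚ.* η)    ≡⟨ ℚₚ.*-assoc X (2ℚ ^ n) η ⟨
  X ℚ.* 2ℚ ^ n ℚ.* η      ≤⟨ *-monoˡ-≤ 0≤η (failure-bound 0≤p p≤1 k n s 1≤kp k3n≤s²) ⟩
  1ℚ ℚ.* η                ≡⟨ ℚₚ.*-identityˡ η ⟩
  η                       ∎
  where
  open ℚₚ.≤-Reasoning
  0≤2ⁿ : 0ℚ ℚ.≤ 2ℚ ^ n
  0≤2ⁿ = ^-nonneg (ℚₚ.nonNegative⁻¹ 2ℚ) n
  X : ℚ
  X = 2ℚ ^ n ℚ.* (2ℚ ^ n ℚ.* (1ℚ ℚ.- p) ^ (s ℕ.* s))
  0≤X : 0ℚ ℚ.≤ X
  0≤X = 0≤* 0≤2ⁿ (0≤* 0≤2ⁿ (^-nonneg (Weights.0≤1-p p 0≤p p≤1) (s ℕ.* s)))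

-- Eventual inequalities between reals

eventually-≤ : ∀ {x y} N → (∀ k → N ℕ.≤ k → seq x k ℚ.≤ seq y k) → x ≤ y
eventually-≤ {x} {y} N x≤y ε 0<ε = N , λ k N≤k → begin
  seq x k           ≤⟨ x≤y k N≤k ⟩
  seq y k           ≡⟨ ℚₚ.+-identityʳ (seq y k) ⟨
  seq y k ℚ.+ 0ℚ    ≤⟨ ℚₚ.+-monoʳ-≤ (seq y k) (ℚₚ.<⇒≤ 0<ε) ⟩
  seq y k ℚ.+ ε     ∎
  where open ℚₚ.≤-Reasoning

module _ (ε : ℝ) {e Nε d} (e≤ε : ∀ k → Nε ℕ.≤ k → 0ℚ ℚ.+ e ℚ.≤ seq ε k) (1≤de : 1ℚ ℚ.≤ ι d ℚ.* e)
  (0≤e : 0ℚ ℚ.≤ e) where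

  -- Here `e` is a rational that `ε` eventually stays above. From sd ≤ n and 1 ≤ de follows s ≤ en,
  -- so losing `s` vertices is affordable.
  large-enough : ∀ n s v → s ℕ.* d ℕ.≤ n → n ℕ.≤ v ℕ.+ s → (1ℝ - ε) * fromℕ n ≤ fromℕ v
  large-enough n s v sd≤n n≤v+s = eventually-≤ {(1ℝ - ε) * fromℕ n} {fromℕ v} Nε λ k Nε≤k → begin
    (1ℚ ℚ.- seq ε k) ℚ.* ι n
      ≤⟨ *-monoˡ-≤ (ι-nonneg n)
           (ℚₚ.+-monoʳ-≤ 1ℚ (ℚₚ.neg-antimono-≤
             (subst (ℚ._≤ seq ε k) (ℚₚ.+-identityˡ e) (e≤ε k Nε≤k)))) ⟩
    (1ℚ ℚ.- e) ℚ.* ι n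
      ≡⟨ solve 2 (λ e n → (con 1ℚ :- e) :* n := n :- e :* n) refl e (ι n) ⟩
    ι n ℚ.- e ℚ.* ι n
      ≤⟨ ℚₚ.+-mono-≤ (subst (ι n ℚ.≤_) (ι-+ v s) (ι-mono n≤v+s)) (ℚₚ.neg-antimono-≤ ιs≤eιn) ⟩
    ι v ℚ.+ ι s ℚ.- ι s
      ≡⟨ solve 2 (λ a b → a :+ b :- b := a) refl (ι v) (ι s) ⟩
    ι v ∎
    where
    open ℚₚ.≤-Reasoning
    ιs≤eιn : ι s ℚ.≤ e ℚ.* ι n
    ιs≤eιn = begin
      ι s                       ≡⟨ ℚₚ.*-identityʳ (ι s) ⟨
      ι s ℚ.* 1ℚ                ≤⟨ *-monoʳ-≤ (ι-nonneg s) 1≤de ⟩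
      ι s ℚ.* (ι d ℚ.* e)       ≡⟨ solve 3 (λ s d e → s :* (d :* e) := e :* (s :* d)) refl (ι s) (ι d) e ⟩
      e ℚ.* (ι s ℚ.* ι d)       ≡⟨ cong (e ℚ.*_) (ι-* s d) ⟨
      e ℚ.* ι (s ℕ.* d)         ≤⟨ *-monoʳ-≤ 0≤e (ι-mono sd≤n) ⟩
      e ℚ.* ι n                 ∎

ℙ-lower-bound : ∀ {n} (P δ : ℝ) (p : ℚ) (E : Event n) {X η : ℚ} {N} → (∀ k → seq P k ≡ p) →
  (∀ k → N ℕ.≤ k → 0ℚ ℚ.+ η ℚ.≤ seq δ k) → X ℚ.≤ η →
  1ℚ ℚ.≤ Weights.𝔼 p (indicator ∘ E) ℚ.+ X → 1ℝ - δ ≤ ℙ P E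
ℙ-lower-bound P δ p E {X} {η} {N} P≡p η≤δ X≤η 1≤𝔼+X =
  eventually-≤ {1ℝ - δ} {ℙ P E} N λ k N≤k → begin
  1ℚ ℚ.- seq δ k
    ≤⟨ ℚₚ.+-monoʳ-≤ 1ℚ (ℚₚ.neg-antimono-≤ (subst (ℚ._≤ seq δ k) (ℚₚ.+-identityˡ η) (η≤δ k N≤k))) ⟩
  1ℚ ℚ.- η
    ≤⟨ ℚₚ.+-mono-≤ 1≤𝔼+X (ℚₚ.neg-antimono-≤ X≤η) ⟩
  Weights.𝔼 p (indicator ∘ E) ℚ.+ X ℚ.- X
    ≡⟨ solve 2 (λ a b → a :+ b :- b := a) refl (Weights.𝔼 p (indicator ∘ E)) X ⟩
  Weights.𝔼 p (indicator ∘ E)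
    ≡⟨ cong (λ q → Weights.𝔼 q (indicator ∘ E)) (P≡p k) ⟨
  Weights.𝔼 (seq P k) (indicator ∘ E)
    ≡⟨ seq-ℙ P k E ⟨
  seq (ℙ P E) k ∎
  where open ℚₚ.≤-Reasoning

-- The edge probability and the choice of parameters

module _ (C n : ℕ) .{{_ : NonZero n}} where

  -- The value of the constant sequence that represents `fromℕ C /ℕ n`.
  edgeProbability : ℚ
  edgeProbability = ι C ℚ.* (ℤ.+ 1 ℚ./ n)

  private
    0≤1/n : 0ℚ ℚ.≤ ℤ.+ 1 ℚ./ n
    0≤1/n = ℚₚ.nonNegative⁻¹ (ℤ.+ 1 ℚ./ n) {{ℚₚ.normalize-nonNeg 1 n}}

    ι-mono-/n : ∀ {a b} → a ℕ.≤ b → ι a ℚ.* (ℤ.+ 1 ℚ./ n) ℚ.≤ ι b ℚ.* (ℤ.+ 1 ℚ./ n)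
    ι-mono-/n a≤b = *-monoˡ-≤ 0≤1/n (ι-mono a≤b)

  edgeProbability-nonneg : 0ℚ ℚ.≤ edgeProbability
  edgeProbability-nonneg = 0≤* (ι-nonneg C) 0≤1/n

  edgeProbability≤1 : C ℕ.≤ n → edgeProbability ℚ.≤ 1ℚ
  edgeProbability≤1 C≤n = subst (edgeProbability ℚ.≤_) (ι-inverse n) (ι-mono-/n C≤n)

  1≤k*edgeProbability : ∀ k → n ℕ.≤ k ℕ.* C → 1ℚ ℚ.≤ ι k ℚ.* edgeProbability
  1≤k*edgeProbability k n≤kC = begin
    1ℚ                                    ≡⟨ ι-inverse n ⟨
    ι n ℚ.* (ℤ.+ 1 ℚ./ n)                 ≤⟨ ι-mono-/n n≤kC ⟩
    ι (k ℕ.* C) ℚ.* (ℤ.+ 1 ℚ./ n)         ≡⟨ cong (ℚ._* (ℤ.+ 1 ℚ./ n)) (ι-* k C) ⟩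
    ι k ℚ.* ι C ℚ.* (ℤ.+ 1 ℚ./ n)         ≡⟨ ℚₚ.*-assoc (ι k) (ι C) (ℤ.+ 1 ℚ./ n) ⟩
    ι k ℚ.* edgeProbability               ∎
    where open ℚₚ.≤-Reasoning

AlmostRigid : ℝ → ∀ n → SimpleGraph (Fin n) → Set
AlmostRigid ε n G = Σ (Subset n) λ V′ →
  ((1ℝ - ε) * fromℕ n ≤ fromℕ (card V′)) × GloballyRigid (induced G V′)

module _ (ε : ℝ) {e Nε d} (e≤ε : ∀ k → Nε ℕ.≤ k → 0ℚ ℚ.+ e ℚ.≤ seq ε k)
  (0≤e : 0ℚ ℚ.≤ e) (1≤de : 1ℚ ℚ.≤ ι d ℚ.* e)
  (δ : ℝ) {η Nδ M} (η≤δ : ∀ k → Nδ ℕ.≤ k → 0ℚ ℚ.+ η ℚ.≤ seq δ k)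
  (0≤η : 0ℚ ℚ.≤ η) (1≤Mη : 1ℚ ℚ.≤ ι M ℚ.* η)
  (P : ℝ) {p} (P≡p : ∀ k → seq P k ≡ p) (0≤p : 0ℚ ℚ.≤ p) (p≤1 : p ℚ.≤ 1ℚ) where

  almostRigid-likely : ∀ {C n} (scale : Scales d C n) → 1ℚ ℚ.≤ ι (Scales.k scale) ℚ.* p → M ℕ.≤ n →
    ProbabilityAtLeast P (AlmostRigid ε n) (1ℝ - δ)
  almostRigid-likely {C} {n} scale 1≤kp M≤n =
    E , rigid , ℙ-lower-bound P δ p E P≡p η≤δ
      (failure-small 0≤p p≤1 0≤η k n s M 1≤kp k3n≤s² 1≤Mη M≤n)
      (Weights.union-bound p 0≤p p≤1 n s)
    where
    open Scales scale
    E : Event n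
    E = Weights.joinedEvent p 0≤p p≤1 n s
    rigid : ∀ ω → T (E ω) → AlmostRigid ε n (graph ω)
    rigid ω Eω =
      let V′ , large , V′-rigid = rigid-core (graph ω) (Weights.adj? p 0≤p p≤1 n s ω) s 0<s 11s≤n
                                    (Weights.joinedEvent⇒joined p 0≤p p≤1 n s ω Eω)
      in V′ , large-enough ε {d = d} e≤ε 1≤de 0≤e n s (card V′) sd≤n large , V′-rigid

theorem1p3 : (ε : ℝ) → 0ℝ < ε →
    Σ ℝ λ C → WithHighProbability (λ n → C /ℕ n) λ n G →
    Σ (Subset n) λ V′ →
    ((1ℝ - ε) * fromℕ n ≤ fromℕ (card V′)) × GloballyRigid (induced G V′)
theorem1p3 ε (e , 0<e , Nε , e≤ε) =
  -- The bound 11 makes s = n/d satisfy 11s ≤ n. `C` is computed from `d` alone, hence before `δ` is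
  -- given.
  let d , 11≤d , 1≤de = archimedean-≥ 11 0<e
      C , scale = scales d 11≤d
  in fromℕ C , λ δ (η , 0<η , Nδ , η≤δ) →
  let M , 1≤Mη = archimedean 0<η
  -- From `C` on, p is at most 1 and the scales exist; from `M` on, the failure probability is at
  -- most `η`.
  in C ⊔ M , λ n {{n≢0}} C⊔M≤n →
  let C≤n = ℕₚ.m⊔n≤o⇒m≤o C M C⊔M≤n
      M≤n = ℕₚ.m⊔n≤o⇒n≤o C M C⊔M≤n
      P   = _/ℕ_ (fromℕ C) n {{n≢0}}
      0≤p = edgeProbability-nonneg C n {{n≢0}}
      p≤1 = edgeProbability≤1 C n {{n≢0}} C≤n
  in eventually-≤ {0ℝ} {P} 0 (λ _ _ → 0≤p) ,
     eventually-≤ {P} {1ℝ} 0 (λ _ _ → p≤1) ,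
     almostRigid-likely ε e≤ε (ℚₚ.<⇒≤ 0<e) 1≤de δ η≤δ (ℚₚ.<⇒≤ 0<η) 1≤Mη P (λ _ → refl) 0≤p p≤1
       (scale n C≤n)
       (1≤k*edgeProbability C n {{n≢0}} (Scales.k (scale n C≤n)) (Scales.n≤kC (scale n C≤n))) M≤n
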